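{- The assignments $\mathbf A\mapsto\mathbf P_{\mathbf A}$, from idempotent residuated chains to enhanced monoidal preorders, and $\mathbf P\mapsto\mathbf A_{\mathbf P}$, from enhanced monoidal preorders to idempotent residuated chains, are inverses of each other: $\mathbf A_{\mathbf P_{\mathbf A}}=\mathbf A$ for every idempotent residuated chain $\mathbf A$, and $\mathbf P_{\mathbf A_{\mathbf P}}=\mathbf P$ for every enhanced monoidal preorder $\mathbf P$.
   Context: A residuated lattice is an algebra $(A,\wedge,\vee,\cdot,\backslash,/,1)$ such that $(A,\wedge,\vee)$ is a lattice, $(A,\cdot,1)$ is a monoid, and $y\le x\backslash z \iff x\cdot y\le z\iff x\le z/y$. An idempotent residuated chain is a residuated lattice whose order is total and which satisfies $x\cdot x=x$. For a preorder $\sqsubseteq$ write $x\sqsubset y$ if $x\sqsubseteq y$ and $y\not\sqsubseteq x$. An enhanced monoidal preorder is a structure $(P,\sqsubseteq,P^+,P^-,1,{}^\star)$ where $\sqsubseteq$ is a preorder on $P$ with $x\sqsubset 1$ for all $x\ne 1$; $P^+,P^-\subseteq P$ are subsets on each of which $\sqsubseteq$ restricts to a total order, with $P^+\cup P^-=P$ and $P^+\cap P^-=\{1\}$; and $^\star$ is a unary operation on $P$ with $1^\star=1$ such that: (1) for $1\ne b\in P^-$, $b^\star$ is the $\sqsubseteq$-smallest element $c$ of $P^+$ such that $b\sqsubset c$; (2) for $1\ne a\in P^+$, $a^\star$ is the $\sqsubseteq$-largest element $c$ of $P^-$ such that $c\sqsubset a$; (3) if two distinct elements $x,y$ satisfy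 neither $x\sqsubset y$ nor $y\sqsubset x$, then one of them lies in $P^+$ and the other in $P^-$, and $\{z:z\sqsubset x\}=\{z:z\sqsubset y\}$ and $\{z:x\sqsubset z\}=\{z:y\sqsubset z\}$. $\mathbf P_{\mathbf A}$: for an idempotent residuated chain $\mathbf A$, $\mathbf P_{\mathbf A}:=(A,\sqsubseteq,A^+,A^-,1,{}^\star)$ where $x\sqsubseteq y$ iff $xy=x$, $A^+=\{x:1\le x\}$, $A^-=\{x:x\le 1\}$, and $x^\star=(1/x)\wedge(x\backslash 1)$. $\mathbf A_{\mathbf P}$: for an enhanced monoidal preorder $\mathbf P$, $\mathbf A_{\mathbf P}$ has underlying set $P$, identity $1$, and order $x\le y$ iff ($x,y\in P^-$ and $x\sqsubseteq y$) or ($x,y\in P^+$ and $y\sqsubseteq x$) or ($x\in P^-$ and $y\in P^+$). Inverses are defined by: if every $y\ne x$ satisfies $x\sqsubset y$ or $y\sqsubset x$, then $x^\ell=x^r=x^\star$; for distinct $a\in P^+$, $b\in P^-$: if $a\sqsubseteq b$ and $b\sqsubseteq a$, then $a^\ell=b$, $a^r=a^\star$, $b^\ell=b^\star$, $b^r=a$; if $a,b$ are $\sqsubseteq$-incomparable, then $a^\ell=a^\star$, $a^r=b$, $b^\ell=a$, $b^r=b^\star$. The remaining operations are: $xy=x\wedge y$ if $x\le y^\ell$ and $xy=x\vee y$ if $y^\ell<x$; $x\backslash y=x^r\vee y$ if $x\le y$ and $x\backslash y=x^r\wedge y$ if $y<x$; $y/x=x^\ell\vee y$ if $x\le y$ and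 $y/x=x^\ell\wedge y$ if $y<x$. -}

module Defs where

open import Level using (Level; suc)
open import Algebra.Core using (Op₁; Op₂)
open import Algebra.Definitions using (Idempotent)
open import Algebra.Structures using (IsMonoid)
open import Axiom.ExcludedMiddle using (ExcludedMiddle)
open import Data.Bool.Base using (if_then_else_)
open import Data.Empty using (⊥-elim)
open import Data.Product.Base using (Σ; ∃; ∃₂; _×_; _,_; proj₁; proj₂)
open import Data.Sum.Base using (_⊎_; inj₁; inj₂)
open import Function.Base using (_on_)
open import Function.Bundles using (_⇔_)
open import Relation.Binary.Core using (Rel)
open import Relation.Binary.Definitions using (Total)
open import Relation.Binary.Lattice.Structures using (IsLattice)
open import Relation.Binary.PropositionalEquality.Core using (_≡_; _≢_; sym)
open import Relation.Binary.Structures using (IsPreorder; IsTotalOrder)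
open import Relation.Nullary using (¬_; yes; no; does)
open import Relation.Unary using (Pred; _∈_; _≐_)

private
  variable
    ℓ : Level

-- Structures are given over a fixed carrier X, so that A_{P_A} and A (resp.
-- P_{A_P} and P) live over the same X and can be compared componentwise.

record RawResiduatedLattice {ℓ : Level} (X : Set ℓ) : Set (suc ℓ) where
  infix  4 _≤_
  infixr 6 _∨_
  infixr 7 _∧_
  infixl 8 _∙_
  infixl 8 _\\_ _//_
  field
    _≤_  : Rel X ℓ
    _∧_  : Op₂ X
    _∨_  : Op₂ X
    _∙_  : Op₂ X
    _\\_ : Op₂ X
    _//_ : Op₂ X
    𝟏    : X

record IsResiduatedLattice {ℓ : Level} {X : Set ℓ} (A : RawResiduatedLattice X) : Set ℓ where
  open RawResiduatedLattice A
  field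
    isLattice : IsLattice _≡_ _≤_ _∨_ _∧_
    isMonoid  : IsMonoid _≡_ _∙_ 𝟏
    residual\ : ∀ x y z → (y ≤ x \\ z) ⇔ (x ∙ y ≤ z)
    residual/ : ∀ x y z → (x ∙ y ≤ z) ⇔ (x ≤ z // y)

record IsIdempotentResiduatedChain {ℓ : Level} {X : Set ℓ} (A : RawResiduatedLattice X) : Set ℓ where
  open RawResiduatedLattice A
  field
    isResiduatedLattice : IsResiduatedLattice A
    total               : Total _≤_
    idempotent          : Idempotent _≡_ _∙_

record IdempotentResiduatedChain {ℓ : Level} (X : Set ℓ) : Set (suc ℓ) where
  constructor mkChain
  field
    raw                         : RawResiduatedLattice X
    isIdempotentResiduatedChain : IsIdempotentResiduatedChain raw

record RawEnhancedMonoidalPreorder {ℓ : Level} (X : Set ℓ) : Set (suc ℓ) where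
  infix 4 _⊑_ _⊏_
  infix 9 _⋆
  field
    _⊑_ : Rel X ℓ
    P⁺  : Pred X ℓ
    P⁻  : Pred X ℓ
    𝟏   : X
    _⋆  : Op₁ X

  _⊏_ : Rel X ℓ
  x ⊏ y = x ⊑ y × ¬ (y ⊑ x)

record IsEnhancedMonoidalPreorder {ℓ : Level} {X : Set ℓ}
                                  (P : RawEnhancedMonoidalPreorder X) : Set ℓ where
  open RawEnhancedMonoidalPreorder P
  field
    isPreorder : IsPreorder _≡_ _⊑_
    ⊏-𝟏        : ∀ x → x ≢ 𝟏 → x ⊏ 𝟏

    -- The restrictions of ⊑ to the subsets, with elements of a subset compared
    -- by their underlying elements of X.
    P⁺-isTotalOrder : IsTotalOrder {A = Σ X P⁺} (_≡_ on proj₁) (_⊑_ on proj₁)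
    P⁻-isTotalOrder : IsTotalOrder {A = Σ X P⁻} (_≡_ on proj₁) (_⊑_ on proj₁)

    P⁺∪P⁻ : ∀ x → x ∈ P⁺ ⊎ x ∈ P⁻
    P⁺∩P⁻ : ∀ x → (x ∈ P⁺ × x ∈ P⁻) ⇔ (x ≡ 𝟏)

    𝟏⋆ : 𝟏 ⋆ ≡ 𝟏

    ⋆-smallest : ∀ b → b ≢ 𝟏 → b ∈ P⁻ →
                 b ⋆ ∈ P⁺ × b ⊏ b ⋆ × (∀ c → c ∈ P⁺ → b ⊏ c → b ⋆ ⊑ c)
    ⋆-largest  : ∀ a → a ≢ 𝟏 → a ∈ P⁺ →
                 a ⋆ ∈ P⁻ × a ⋆ ⊏ a × (∀ c → c ∈ P⁻ → c ⊏ a → c ⊑ a ⋆)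

    twins : ∀ x y → x ≢ y → ¬ (x ⊏ y) → ¬ (y ⊏ x) →
            ((x ∈ P⁺ × y ∈ P⁻) ⊎ (x ∈ P⁻ × y ∈ P⁺)) ×
            ((λ z → z ⊏ x) ≐ (λ z → z ⊏ y)) ×
            ((λ z → x ⊏ z) ≐ (λ z → y ⊏ z))

record EnhancedMonoidalPreorder {ℓ : Level} (X : Set ℓ) : Set (suc ℓ) where
  constructor mkPreorder
  field
    raw                        : RawEnhancedMonoidalPreorder X
    isEnhancedMonoidalPreorder : IsEnhancedMonoidalPreorder raw

-- Equality of structures over the same carrier: operations agree pointwise and
-- relations and subsets have the same extension.

infix 4 _≈ᴬ_ _≈ᴾ_

record _≈ᴬ_ {ℓ : Level} {X : Set ℓ} (A B : RawResiduatedLattice X) : Set ℓ where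
  private
    module A = RawResiduatedLattice A
    module B = RawResiduatedLattice B
  field
    ≤-≈  : ∀ x y → (x A.≤ y) ⇔ (x B.≤ y)
    ∧-≈  : ∀ x y → x A.∧ y ≡ x B.∧ y
    ∨-≈  : ∀ x y → x A.∨ y ≡ x B.∨ y
    ∙-≈  : ∀ x y → x A.∙ y ≡ x B.∙ y
    \\-≈ : ∀ x y → x A.\\ y ≡ x B.\\ y
    //-≈ : ∀ x y → x A.// y ≡ x B.// y
    𝟏-≈  : A.𝟏 ≡ B.𝟏

record _≈ᴾ_ {ℓ : Level} {X : Set ℓ} (P Q : RawEnhancedMonoidalPreorder X) : Set ℓ where
  private
    module P = RawEnhancedMonoidalPreorder P
    module Q = RawEnhancedMonoidalPreorder Q
  field
    ⊑-≈  : ∀ x y → (x P.⊑ y) ⇔ (x Q.⊑ y)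
    P⁺-≈ : P.P⁺ ≐ Q.P⁺
    P⁻-≈ : P.P⁻ ≐ Q.P⁻
    𝟏-≈  : P.𝟏 ≡ Q.𝟏
    ⋆-≈  : ∀ x → x P.⋆ ≡ x Q.⋆

toPreorder : {X : Set ℓ} → IdempotentResiduatedChain X → RawEnhancedMonoidalPreorder X
toPreorder A = record
  { _⊑_ = λ x y → x ∙ y ≡ x
  ; P⁺  = λ x → 𝟏 ≤ x
  ; P⁻  = λ x → x ≤ 𝟏
  ; 𝟏   = 𝟏
  ; _⋆  = λ x → (𝟏 // x) ∧ (x \\ 𝟏)
  }
  where
  open IdempotentResiduatedChain A
  open RawResiduatedLattice raw

module _ {ℓ : Level} {X : Set ℓ} (P : RawEnhancedMonoidalPreorder X) where
  open RawEnhancedMonoidalPreorder P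

  -- Inverses x l r : the definition by cases yields xˡ = l and xʳ = r.  In an
  -- enhanced monoidal preorder every x has inverses (inverses below), and they
  -- are unique, since x has at most one twin y, i.e. y ≢ x with neither
  -- x ⊏ y nor y ⊏ x.
  data Inverses : X → X → X → Set ℓ where
    no-twin       : ∀ {x} → (∀ y → y ≢ x → x ⊏ y ⊎ y ⊏ x) → Inverses x (x ⋆) (x ⋆)
    equivalent⁺   : ∀ {a b} → a ≢ b → a ∈ P⁺ → b ∈ P⁻ →
                    a ⊑ b → b ⊑ a → Inverses a b (a ⋆)
    equivalent⁻   : ∀ {a b} → a ≢ b → a ∈ P⁺ → b ∈ P⁻ →
                    a ⊑ b → b ⊑ a → Inverses b (b ⋆) a
    incomparable⁺ : ∀ {a b} → a ≢ b → a ∈ P⁺ → b ∈ P⁻ →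
                    ¬ (a ⊑ b) → ¬ (b ⊑ a) → Inverses a (a ⋆) b
    incomparable⁻ : ∀ {a b} → a ≢ b → a ∈ P⁺ → b ∈ P⁻ →
                    ¬ (a ⊑ b) → ¬ (b ⊑ a) → Inverses b a (b ⋆)

-- The case distinctions defining A_P are undecidable on an arbitrary infinite
-- carrier, so the construction takes excluded middle as an argument.
module _ {ℓ : Level} (em : ExcludedMiddle ℓ) {X : Set ℓ} where

  when_then_else_ : Set ℓ → X → X → X
  when Q then x else y = if does (em {Q}) then x else y

  module _ (P : EnhancedMonoidalPreorder X) where
    open EnhancedMonoidalPreorder P
    open RawEnhancedMonoidalPreorder raw
    open IsEnhancedMonoidalPreorder isEnhancedMonoidalPreorder

    private
      Twin : Rel X ℓ
      Twin x y = y ≢ x × ¬ (x ⊏ y) × ¬ (y ⊏ x)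

      ⊏-or-⊐ : ∀ {x} → ¬ ∃ (Twin x) → ∀ y → y ≢ x → x ⊏ y ⊎ y ⊏ x
      ⊏-or-⊐ {x} ¬t y y≢x with em {x ⊏ y} | em {y ⊏ x}
      ... | yes p | _     = inj₁ p
      ... | no _  | yes q = inj₂ q
      ... | no ¬p | no ¬q = ⊥-elim (¬t (y , y≢x , ¬p , ¬q))

      equivalent-or-incomparable : ∀ x y → ¬ (x ⊏ y) → ¬ (y ⊏ x) →
        (x ⊑ y × y ⊑ x) ⊎ (¬ (x ⊑ y) × ¬ (y ⊑ x))
      equivalent-or-incomparable x y ¬p ¬q with em {x ⊑ y} | em {y ⊑ x}
      ... | yes p | yes q = inj₁ (p , q)
      ... | yes p | no q  = ⊥-elim (¬p (p , q))
      ... | no p  | yes q = ⊥-elim (¬q (q , p))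
      ... | no p  | no q  = inj₂ (p , q)

    inverses : ∀ x → ∃₂ λ l r → Inverses raw x l r
    inverses x with em {∃ (Twin x)}
    ... | no ¬t = x ⋆ , x ⋆ , no-twin (⊏-or-⊐ ¬t)
    ... | yes (y , y≢x , ¬x⊏y , ¬y⊏x)
      with proj₁ (twins x y (λ x≡y → y≢x (sym x≡y)) ¬x⊏y ¬y⊏x)
         | equivalent-or-incomparable x y ¬x⊏y ¬y⊏x
    ... | inj₁ (x⁺ , y⁻) | inj₁ (p , q) =
          y , x ⋆ , equivalent⁺ (λ x≡y → y≢x (sym x≡y)) x⁺ y⁻ p q
    ... | inj₁ (x⁺ , y⁻) | inj₂ (p , q) =
          x ⋆ , y , incomparable⁺ (λ x≡y → y≢x (sym x≡y)) x⁺ y⁻ p q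
    ... | inj₂ (x⁻ , y⁺) | inj₁ (p , q) = x ⋆ , y , equivalent⁻ y≢x y⁺ x⁻ q p
    ... | inj₂ (x⁻ , y⁺) | inj₂ (p , q) = y , x ⋆ , incomparable⁻ y≢x y⁺ x⁻ q p

    -- As ≤ is a total order, meet and join are minimum and maximum, and the
    -- conditions yˡ < x and y < x of the second cases are the negations of
    -- x ≤ yˡ and x ≤ y.
    toChain : RawResiduatedLattice X
    toChain = record
      { _≤_  = _≤_
      ; _∧_  = _∧_
      ; _∨_  = _∨_
      ; _∙_  = λ x y → when x ≤ (y ˡ) then x ∧ y else (x ∨ y)
      ; _\\_ = λ x y → when x ≤ y then (x ʳ) ∨ y else ((x ʳ) ∧ y)
      ; _//_ = λ y x → when x ≤ y then (x ˡ) ∨ y else ((x ˡ) ∧ y)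
      ; 𝟏    = 𝟏
      }
      where
      infix  4 _≤_
      infixr 7 _∧_
      infixr 6 _∨_

      _≤_ : Rel X ℓ
      x ≤ y = (x ∈ P⁻ × y ∈ P⁻ × x ⊑ y)
            ⊎ (x ∈ P⁺ × y ∈ P⁺ × y ⊑ x)
            ⊎ (x ∈ P⁻ × y ∈ P⁺)

      _∧_ _∨_ : Op₂ X
      x ∧ y = when x ≤ y then x else y
      x ∨ y = when x ≤ y then y else x

      _ˡ _ʳ : Op₁ X
      x ˡ = proj₁ (inverses x)
      x ʳ = proj₁ (proj₂ (inverses x))

{-# OPTIONS --safe #-}
module Submission where

open import Axiom.ExcludedMiddle using (ExcludedMiddle)
open import Data.Product.Base using (Σ; _×_)
open import Level using (Level)
open import Defs

open import Algebra.Core using (Op₁; Op₂)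
open import Algebra.Structures using (IsMonoid)
open import Data.Product.Base using (_,_; proj₁; proj₂; swap)
open import Data.Sum.Base using (_⊎_; inj₁; inj₂; [_,_]′)
open import Function.Base using (id; _∘_)
open import Function.Bundles using (_⇔_; mk⇔; Equivalence)
import Function.Properties.Equivalence as ⇔
open import Relation.Binary.Core using (Rel)
open import Relation.Binary.Lattice.Bundles using (Lattice)
open import Relation.Binary.Lattice.Structures using (IsLattice)
import Relation.Binary.Construct.On as On
import Relation.Binary.Lattice.Properties.JoinSemilattice as JoinSemilattice
import Relation.Binary.Lattice.Properties.MeetSemilattice as MeetSemilattice
open import Relation.Binary.PropositionalEquality
  using (_≡_; _≢_; refl; sym; trans; cong; cong₂; subst; ≢-sym; isEquivalence; module ≡-Reasoning)
open import Relation.Binary.Structures using (IsPreorder; IsTotalOrder)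
open import Relation.Nullary using (¬_; yes; no; contradiction)
open import Relation.Unary using (_∈_; _∉_)

open Equivalence using (to; from)

-- In an idempotent residuated chain xy lies below x and y if xy ≤ 1, and above
-- them if 1 ≤ xy, so xy ∈ {x , y}; since x ⊑ y means xy = x, the preorder
-- determines the product: xy is x if x ⊑ y, and y otherwise.  Conversely, on an
-- enhanced monoidal preorder this rule defines a product that agrees with the one
-- of A_P, because both x ≤ yˡ and y ≤ xʳ express that it is negative.  Its
-- associativity comes down to the transitivity of ⋢ up to equality, which is what
-- axiom (3) on twins provides.

-- Two distinct elements commute exactly when they are strictly comparable, so twins are the
-- noncommuting pairs: equivalent twins multiply as left zeros, incomparable twins as right zeros,
-- and hence the two kinds get mirrored inverses. For `y ≢ 𝟏`, an inverse of `y` is extremal on the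
-- opposite side for a weak condition such as `y ⊑ x` or `¬ (x ⊑ y)`, whereas `y ⋆` is extremal for
-- the strict `⊏`. The two can differ only if the twin of `y` meets the weak condition, and then the
-- inverse is the twin. Neither round trip compares formulas: lattice operations and residuals are
-- determined by order and product, and `⋆` by axioms (1) and (2). Both uniqueness arguments rely on
-- the constructed structure satisfying its axioms. A recurring obstacle is `𝟏`, which lies in both
-- `P⁺` and `P⁻`.

module _ {ℓ : Level} (em : ExcludedMiddle ℓ) {X : Set ℓ} where

  when-true : ∀ {Q : Set ℓ} {x y : X} → Q → when_then_else_ em Q x y ≡ x
  when-true {Q} q with em {Q}
  ... | yes _ = refl
  ... | no ¬q = contradiction q ¬q

  when-false : ∀ {Q : Set ℓ} {x y : X} → ¬ Q → when_then_else_ em Q x y ≡ y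
  when-false {Q} ¬q with em {Q}
  ... | yes q = contradiction q ¬q
  ... | no _  = refl

-- Minimum, maximum and residuation by cases over a total order.

module MinMax {ℓ : Level} (em : ExcludedMiddle ℓ) {X : Set ℓ} {_≤_ : Rel X ℓ}
              (isTotalOrder : IsTotalOrder _≡_ _≤_) where
  open IsTotalOrder isTotalOrder renaming (refl to ≤-refl; trans to ≤-trans)

  infixr 7 _∧_
  infixr 6 _∨_

  _∧_ _∨_ : Op₂ X
  x ∧ y = when_then_else_ em (x ≤ y) x y
  x ∨ y = when_then_else_ em (x ≤ y) y x

  ≰⇒≥ : ∀ {x y} → ¬ (x ≤ y) → y ≤ x
  ≰⇒≥ {x} {y} x≰y = [ (λ x≤y → contradiction x≤y x≰y) , id ]′ (total x y)

  x≤y⇒x∧y≡x : ∀ {x y} → x ≤ y → x ∧ y ≡ x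
  x≤y⇒x∧y≡x = when-true em

  x≤y⇒x∨y≡y : ∀ {x y} → x ≤ y → x ∨ y ≡ y
  x≤y⇒x∨y≡y = when-true em

  y≤x⇒x∧y≡y : ∀ {x y} → y ≤ x → x ∧ y ≡ y
  y≤x⇒x∧y≡y {x} {y} y≤x with em {x ≤ y}
  ... | yes x≤y = antisym x≤y y≤x
  ... | no _    = refl

  y≤x⇒x∨y≡x : ∀ {x y} → y ≤ x → x ∨ y ≡ x
  y≤x⇒x∨y≡x {x} {y} y≤x with em {x ≤ y}
  ... | yes x≤y = antisym y≤x x≤y
  ... | no _    = refl

  isLattice : IsLattice _≡_ _≤_ _∨_ _∧_
  isLattice = record
    { isPartialOrder = isPartialOrder
    ; supremum       = supremum
    ; infimum        = infimum
    }
    where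
    supremum : ∀ x y → x ≤ (x ∨ y) × y ≤ (x ∨ y) × (∀ z → x ≤ z → y ≤ z → (x ∨ y) ≤ z)
    supremum x y with em {x ≤ y}
    ... | yes x≤y = x≤y , ≤-refl , λ _ _ y≤z → y≤z
    ... | no x≰y  = ≤-refl , ≰⇒≥ x≰y , λ _ x≤z _ → x≤z

    infimum : ∀ x y → (x ∧ y) ≤ x × (x ∧ y) ≤ y × (∀ z → z ≤ x → z ≤ y → z ≤ (x ∧ y))
    infimum x y with em {x ≤ y}
    ... | yes x≤y = ≤-refl , x≤y , λ _ z≤x _ → z≤x
    ... | no x≰y  = ≰⇒≥ x≰y , ≤-refl , λ _ _ z≤y → z≤y

  lattice : Lattice ℓ ℓ ℓ
  lattice = record { isLattice = isLattice }

  open Lattice lattice public using (x≤x∨y; y≤x∨y; ∨-least; x∧y≤x; x∧y≤y; ∧-greatest)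
  open JoinSemilattice (Lattice.joinSemilattice lattice) public using (∨-comm)
  open MeetSemilattice (Lattice.meetSemilattice lattice) public using (∧-comm)

  module _ {Q : Set ℓ} {l x y z : X} (Q⇔x≤l : Q ⇔ (x ≤ l)) where
    private
      product residual : X
      product  = when_then_else_ em Q (x ∧ y) (x ∨ y)
      residual = when_then_else_ em (y ≤ z) (l ∨ z) (l ∧ z)

    -- If `Q` and `y ≤ z` agree in truth value, both sides are true or both false. If only `Q`
    -- holds, both say `x ≤ z`, as `x ≤ l` is given; if only `y ≤ z` holds, both say `x ≤ z`, as
    -- `x ≤ l` fails. The guard `Q` is abstract so that one proof serves both residuals.
    residuation : (product ≤ z) ⇔ (x ≤ residual)
    residuation with em {Q} | em {y ≤ z}
    ... | yes q | yes y≤z = mk⇔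
      (λ _ → ≤-trans (to Q⇔x≤l q) (x≤x∨y _ _))
      (λ _ → ≤-trans (x∧y≤y x y) y≤z)
    ... | yes q | no y≰z = mk⇔
      (λ p≤z → ∧-greatest (to Q⇔x≤l q)
                 ([ (λ x≤y → subst (_≤ z) (x≤y⇒x∧y≡x x≤y) p≤z)
                  , (λ y≤x → contradiction (subst (_≤ z) (y≤x⇒x∧y≡y y≤x) p≤z) y≰z)
                  ]′ (total x y)))
      (λ x≤r → ≤-trans (x∧y≤x x y) (≤-trans x≤r (x∧y≤y _ _)))
    ... | no ¬q | yes y≤z = mk⇔
      (λ p≤z → ≤-trans (x≤x∨y x y) (≤-trans p≤z (y≤x∨y _ _)))
      (λ x≤r → ∨-least
                 ([ (λ l≤z → subst (x ≤_) (x≤y⇒x∨y≡y l≤z) x≤r)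
                  , (λ z≤l → contradiction (from Q⇔x≤l (subst (x ≤_) (y≤x⇒x∨y≡x z≤l) x≤r)) ¬q)
                  ]′ (total l z))
                 y≤z)
    ... | no ¬q | no y≰z = mk⇔
      (λ p≤z → contradiction (≤-trans (y≤x∨y x y) p≤z) y≰z)
      (λ x≤r → contradiction (from Q⇔x≤l (≤-trans x≤r (x∧y≤x _ _))) ¬q)

-- The enhanced monoidal preorder of an idempotent residuated chain.

module ChainToPreorder {ℓ : Level} {X : Set ℓ} (A : IdempotentResiduatedChain X) where
  open IdempotentResiduatedChain A
  open RawResiduatedLattice raw
  open IsIdempotentResiduatedChain isIdempotentResiduatedChain
  open IsResiduatedLattice isResiduatedLattice
  open IsLattice isLattice
    using (antisym; x∧y≤x; x∧y≤y; ∧-greatest; ≤-respˡ-≈; ≤-respʳ-≈)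
    renaming (refl to ≤-refl; trans to ≤-trans; reflexive to ≤-reflexive)
  open IsMonoid isMonoid using (assoc; identityˡ; identityʳ)
  open RawEnhancedMonoidalPreorder (toPreorder A) using (_⊑_; _⊏_; _⋆)

  ∙-monoˡ-≤ : ∀ {x y} z → x ≤ y → x ∙ z ≤ y ∙ z
  ∙-monoˡ-≤ z x≤y = from (residual/ _ _ _) (≤-trans x≤y (to (residual/ _ _ _) ≤-refl))

  ∙-monoʳ-≤ : ∀ {x y} z → x ≤ y → z ∙ x ≤ z ∙ y
  ∙-monoʳ-≤ z x≤y = to (residual\ _ _ _) (≤-trans x≤y (from (residual\ _ _ _) ≤-refl))

  absorbˡ : ∀ x y → x ∙ (x ∙ y) ≡ x ∙ y
  absorbˡ x y = trans (sym (assoc x x y)) (cong (_∙ y) (idempotent x))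

  absorbʳ : ∀ x y → (x ∙ y) ∙ y ≡ x ∙ y
  absorbʳ x y = trans (assoc x y y) (cong (x ∙_) (idempotent y))

  -- Multiplying `x ∙ y ≤ 𝟏` by `x` on the left leaves `x ∙ y` unchanged, by idempotence, and turns
  -- `𝟏` into `x`. The three companions use the other factor or start from `𝟏 ≤ x ∙ y`.
  xy≤𝟏⇒xy≤x : ∀ {x y} → x ∙ y ≤ 𝟏 → x ∙ y ≤ x
  xy≤𝟏⇒xy≤x {x} {y} xy≤𝟏 =
    ≤-respˡ-≈ (absorbˡ x y) (≤-respʳ-≈ (identityʳ x) (∙-monoʳ-≤ x xy≤𝟏))

  xy≤𝟏⇒xy≤y : ∀ {x y} → x ∙ y ≤ 𝟏 → x ∙ y ≤ y
  xy≤𝟏⇒xy≤y {x} {y} xy≤𝟏 =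
    ≤-respˡ-≈ (absorbʳ x y) (≤-respʳ-≈ (identityˡ y) (∙-monoˡ-≤ y xy≤𝟏))

  𝟏≤xy⇒x≤xy : ∀ {x y} → 𝟏 ≤ x ∙ y → x ≤ x ∙ y
  𝟏≤xy⇒x≤xy {x} {y} 𝟏≤xy =
    ≤-respʳ-≈ (absorbˡ x y) (≤-respˡ-≈ (identityʳ x) (∙-monoʳ-≤ x 𝟏≤xy))

  𝟏≤xy⇒y≤xy : ∀ {x y} → 𝟏 ≤ x ∙ y → y ≤ x ∙ y
  𝟏≤xy⇒y≤xy {x} {y} 𝟏≤xy =
    ≤-respʳ-≈ (absorbʳ x y) (≤-respˡ-≈ (identityˡ y) (∙-monoˡ-≤ y 𝟏≤xy))

  x≤y⇒x≤xy : ∀ {x y} → x ≤ y → x ≤ x ∙ y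
  x≤y⇒x≤xy {x} x≤y = ≤-respˡ-≈ (idempotent x) (∙-monoʳ-≤ x x≤y)

  x≤y⇒xy≤y : ∀ {x y} → x ≤ y → x ∙ y ≤ y
  x≤y⇒xy≤y {_} {y} x≤y = ≤-respʳ-≈ (idempotent y) (∙-monoˡ-≤ y x≤y)

  y≤x⇒y≤xy : ∀ {x y} → y ≤ x → y ≤ x ∙ y
  y≤x⇒y≤xy {_} {y} y≤x = ≤-respˡ-≈ (idempotent y) (∙-monoˡ-≤ y y≤x)

  y≤x⇒xy≤x : ∀ {x y} → y ≤ x → x ∙ y ≤ x
  y≤x⇒xy≤x {x} y≤x = ≤-respʳ-≈ (idempotent x) (∙-monoʳ-≤ x y≤x)

  -- Monotonicity and idempotence put `x ∙ y` between `x` and `y`. Being also below both, or above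
  -- both, it is their minimum or their maximum.
  selective : ∀ x y → x ∙ y ≡ x ⊎ x ∙ y ≡ y
  selective x y with total (x ∙ y) 𝟏 | total x y
  ... | inj₁ xy≤𝟏 | inj₁ x≤y = inj₁ (antisym (xy≤𝟏⇒xy≤x xy≤𝟏) (x≤y⇒x≤xy x≤y))
  ... | inj₁ xy≤𝟏 | inj₂ y≤x = inj₂ (antisym (xy≤𝟏⇒xy≤y xy≤𝟏) (y≤x⇒y≤xy y≤x))
  ... | inj₂ 𝟏≤xy | inj₁ x≤y = inj₂ (antisym (x≤y⇒xy≤y x≤y) (𝟏≤xy⇒y≤xy 𝟏≤xy))
  ... | inj₂ 𝟏≤xy | inj₂ y≤x = inj₁ (antisym (y≤x⇒xy≤x y≤x) (𝟏≤xy⇒x≤xy 𝟏≤xy))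

  xy≢x⇒xy≡y : ∀ {x y} → x ∙ y ≢ x → x ∙ y ≡ y
  xy≢x⇒xy≡y {x} {y} xy≢x = [ (λ xy≡x → contradiction xy≡x xy≢x) , id ]′ (selective x y)

  xy≢y⇒xy≡x : ∀ {x y} → x ∙ y ≢ y → x ∙ y ≡ x
  xy≢y⇒xy≡x {x} {y} xy≢y = [ id , (λ xy≡y → contradiction xy≡y xy≢y) ]′ (selective x y)

  x≤𝟏⇒xy≤y : ∀ {x y} → x ≤ 𝟏 → x ∙ y ≤ y
  x≤𝟏⇒xy≤y {_} {y} x≤𝟏 = ≤-respʳ-≈ (identityˡ y) (∙-monoˡ-≤ y x≤𝟏)

  y≤𝟏⇒xy≤x : ∀ {x y} → y ≤ 𝟏 → x ∙ y ≤ x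
  y≤𝟏⇒xy≤x {x} y≤𝟏 = ≤-respʳ-≈ (identityʳ x) (∙-monoʳ-≤ x y≤𝟏)

  𝟏≤x⇒y≤xy : ∀ {x y} → 𝟏 ≤ x → y ≤ x ∙ y
  𝟏≤x⇒y≤xy {_} {y} 𝟏≤x = ≤-respˡ-≈ (identityˡ y) (∙-monoˡ-≤ y 𝟏≤x)

  𝟏≤y⇒x≤xy : ∀ {x y} → 𝟏 ≤ y → x ≤ x ∙ y
  𝟏≤y⇒x≤xy {x} 𝟏≤y = ≤-respˡ-≈ (identityʳ x) (∙-monoʳ-≤ x 𝟏≤y)

  ⊑⇔≤ : ∀ {x y} → x ≤ 𝟏 → y ≤ 𝟏 → (x ⊑ y) ⇔ (x ≤ y)
  ⊑⇔≤ x≤𝟏 y≤𝟏 = mk⇔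
    (λ xy≡x → ≤-respˡ-≈ xy≡x (x≤𝟏⇒xy≤y x≤𝟏))
    (λ x≤y → antisym (y≤𝟏⇒xy≤x y≤𝟏) (x≤y⇒x≤xy x≤y))

  ⊑⇔≥ : ∀ {x y} → 𝟏 ≤ x → 𝟏 ≤ y → (x ⊑ y) ⇔ (y ≤ x)
  ⊑⇔≥ 𝟏≤x 𝟏≤y = mk⇔
    (λ xy≡x → ≤-respʳ-≈ xy≡x (𝟏≤x⇒y≤xy 𝟏≤x))
    (λ y≤x → antisym (y≤x⇒xy≤x y≤x) (𝟏≤y⇒x≤xy 𝟏≤y))

  ⊑-isPreorder : IsPreorder _≡_ _⊑_
  ⊑-isPreorder = record
    { isEquivalence = isEquivalence
    ; reflexive     = λ { {x} refl → idempotent x }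
    ; trans         = λ {x} {y} {z} xy≡x yz≡y → begin
        x ∙ z        ≡⟨ cong (_∙ z) xy≡x ⟨
        (x ∙ y) ∙ z  ≡⟨ assoc x y z ⟩
        x ∙ (y ∙ z)  ≡⟨ cong (x ∙_) yz≡y ⟩
        x ∙ y        ≡⟨ xy≡x ⟩
        x            ∎
    }
    where open ≡-Reasoning

  ⊏⇒yx≡x : ∀ {x y} → x ⊏ y → y ∙ x ≡ x
  ⊏⇒yx≡x (_ , yx≢y) = xy≢x⇒xy≡y yx≢y

  ⊏⇒≢ : ∀ {x y} → x ⊏ y → x ≢ y
  ⊏⇒≢ (xx≡x , xx≢x) refl = xx≢x xx≡x

  commuting⇒⊏ : ∀ {x y} → x ≢ y → x ∙ y ≡ x → y ∙ x ≡ x → x ⊏ y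
  commuting⇒⊏ x≢y xy≡x yx≡x = xy≡x , λ yx≡y → x≢y (trans (sym yx≡x) yx≡y)

  ⊏-𝟏 : ∀ x → x ≢ 𝟏 → x ⊏ 𝟏
  ⊏-𝟏 x x≢𝟏 = commuting⇒⊏ x≢𝟏 (identityʳ x) (identityˡ x)

  -- The meet of the two residuals into `𝟏` is thereby the greatest two-sided solution `c`; the
  -- formula for `⋆` enters the rest of the argument only through this property.
  ⋆-adjoint : ∀ {x c} → (c ≤ x ⋆) ⇔ (x ∙ c ≤ 𝟏 × c ∙ x ≤ 𝟏)
  ⋆-adjoint {x} {c} = mk⇔
    (λ c≤x⋆ → to (residual\ x c 𝟏) (≤-trans c≤x⋆ (x∧y≤y _ _))
            , from (residual/ c x 𝟏) (≤-trans c≤x⋆ (x∧y≤x _ _)))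
    (λ (xc≤𝟏 , cx≤𝟏) → ∧-greatest (to (residual/ c x 𝟏) cx≤𝟏) (from (residual\ x c 𝟏) xc≤𝟏))

  ⊏⇒commuting≤𝟏 : ∀ {x y} → x ≤ 𝟏 → x ⊏ y → x ∙ y ≤ 𝟏 × y ∙ x ≤ 𝟏
  ⊏⇒commuting≤𝟏 x≤𝟏 x⊏y =
    ≤-trans (≤-reflexive (proj₁ x⊏y)) x≤𝟏 , ≤-trans (≤-reflexive (⊏⇒yx≡x x⊏y)) x≤𝟏

  -- Both products lie between `x` and `y`, and a product below `𝟏` lies below its factors, so both
  -- products equal `x`. Thus strict comparability becomes the condition that `⋆-adjoint` speaks of.
  commuting≤𝟏⇒⊏ : ∀ {x y} → x ≢ y → x ≤ y → x ∙ y ≤ 𝟏 × y ∙ x ≤ 𝟏 → x ⊏ y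
  commuting≤𝟏⇒⊏ x≢y x≤y (xy≤𝟏 , yx≤𝟏) = commuting⇒⊏ x≢y
    (antisym (xy≤𝟏⇒xy≤x xy≤𝟏) (x≤y⇒x≤xy x≤y))
    (antisym (xy≤𝟏⇒xy≤y yx≤𝟏) (y≤x⇒y≤xy x≤y))

  ⋆-smallest : ∀ b → b ≢ 𝟏 → b ≤ 𝟏 →
               𝟏 ≤ b ⋆ × b ⊏ b ⋆ × (∀ c → 𝟏 ≤ c → b ⊏ c → b ⋆ ⊑ c)
  ⋆-smallest b b≢𝟏 b≤𝟏 = 𝟏≤b⋆ , b⊏b⋆ , λ c 𝟏≤c b⊏c →
    -- On positive elements `⊑` reverses `≤`, so the `≤`-greatest solution is the `⊑`-smallest one.
    from (⊑⇔≥ 𝟏≤b⋆ 𝟏≤c) (from ⋆-adjoint (⊏⇒commuting≤𝟏 b≤𝟏 b⊏c))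
    where
    𝟏≤b⋆ : 𝟏 ≤ b ⋆
    𝟏≤b⋆ = from ⋆-adjoint ( ≤-respˡ-≈ (sym (identityʳ b)) b≤𝟏
                          , ≤-respˡ-≈ (sym (identityˡ b)) b≤𝟏)

    b⊏b⋆ : b ⊏ b ⋆
    b⊏b⋆ = commuting≤𝟏⇒⊏ (λ b≡b⋆ → b≢𝟏 (antisym b≤𝟏 (≤-respʳ-≈ (sym b≡b⋆) 𝟏≤b⋆)))
                         (≤-trans b≤𝟏 𝟏≤b⋆) (to ⋆-adjoint ≤-refl)

  ⋆-largest : ∀ a → a ≢ 𝟏 → 𝟏 ≤ a →
              a ⋆ ≤ 𝟏 × a ⋆ ⊏ a × (∀ c → c ≤ 𝟏 → c ⊏ a → c ⊑ a ⋆)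
  ⋆-largest a a≢𝟏 𝟏≤a = a⋆≤𝟏 , a⋆⊏a , λ c c≤𝟏 c⊏a →
    from (⊑⇔≤ c≤𝟏 a⋆≤𝟏) (from ⋆-adjoint (swap (⊏⇒commuting≤𝟏 c≤𝟏 c⊏a)))
    where
    a⋆-commuting : a ∙ a ⋆ ≤ 𝟏 × a ⋆ ∙ a ≤ 𝟏
    a⋆-commuting = to ⋆-adjoint ≤-refl

    𝟏≰a⋆ : ¬ (𝟏 ≤ a ⋆)
    𝟏≰a⋆ 𝟏≤a⋆ = a≢𝟏 (antisym (≤-trans (𝟏≤y⇒x≤xy 𝟏≤a⋆) (proj₁ a⋆-commuting)) 𝟏≤a)

    a⋆≤𝟏 : a ⋆ ≤ 𝟏
    a⋆≤𝟏 = [ id , (λ 𝟏≤a⋆ → contradiction 𝟏≤a⋆ 𝟏≰a⋆) ]′ (total (a ⋆) 𝟏)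

    a⋆⊏a : a ⋆ ⊏ a
    a⋆⊏a = commuting≤𝟏⇒⊏ (λ a⋆≡a → 𝟏≰a⋆ (≤-respʳ-≈ (sym a⋆≡a) 𝟏≤a))
                         (≤-trans a⋆≤𝟏 𝟏≤a) (swap a⋆-commuting)

  -- `selective` leaves four values for the pair of products. The two in which the factors commute
  -- give `⊏` one way or the other. Incomparability is recorded by equations rather than negations,
  -- so that it can be combined with associativity.
  equivalent-or-rightZero : ∀ {x y} → x ≢ y → ¬ (x ⊏ y) → ¬ (y ⊏ x) →
                            (x ⊑ y × y ⊑ x) ⊎ (x ∙ y ≡ y × y ∙ x ≡ x)
  equivalent-or-rightZero {x} {y} x≢y ¬x⊏y ¬y⊏x with selective x y | selective y x
  ... | inj₁ xy≡x | inj₁ yx≡y = inj₁ (xy≡x , yx≡y)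
  ... | inj₁ xy≡x | inj₂ yx≡x = contradiction (commuting⇒⊏ x≢y xy≡x yx≡x) ¬x⊏y
  ... | inj₂ xy≡y | inj₁ yx≡y = contradiction (commuting⇒⊏ (≢-sym x≢y) yx≡y xy≡y) ¬y⊏x
  ... | inj₂ xy≡y | inj₂ yx≡x = inj₂ (xy≡y , yx≡x)

  -- For equivalent twins this is transitivity of `⊑`. For right-zero twins, writing `x` as `y ∙ x`
  -- and reassociating gives `y ∙ z ≡ z` and excludes `z ∙ y ≡ y`, so `selective` leaves
  -- `z ∙ y ≡ z`. `twin-upper` writes `y` as `x ∙ y` instead.
  twin-lower : ∀ {x y} → (x ⊑ y × y ⊑ x) ⊎ (x ∙ y ≡ y × y ∙ x ≡ x) → ∀ {z} → z ⊏ x → z ⊏ y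
  twin-lower (inj₁ (x⊑y , y⊑x)) (z⊑x , x⋢z) = ⊑-trans z⊑x x⊑y , x⋢z ∘ ⊑-trans x⊑y
    where open IsPreorder ⊑-isPreorder using () renaming (trans to ⊑-trans)
  twin-lower {x} {y} (inj₂ (xy≡y , yx≡x)) {z} z⊏x = commuting⇒⊏ z≢y (xy≢y⇒xy≡x zy≢y) yz≡z
    where
    open ≡-Reasoning

    yz≡z : y ∙ z ≡ z
    yz≡z = begin
      y ∙ z        ≡⟨ cong (y ∙_) (⊏⇒yx≡x z⊏x) ⟨
      y ∙ (x ∙ z)  ≡⟨ assoc y x z ⟨
      (y ∙ x) ∙ z  ≡⟨ cong (_∙ z) yx≡x ⟩
      x ∙ z        ≡⟨ ⊏⇒yx≡x z⊏x ⟩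
      z            ∎

    zy≢y : z ∙ y ≢ y
    zy≢y zy≡y = ⊏⇒≢ z⊏x (begin
      z            ≡⟨ proj₁ z⊏x ⟨
      z ∙ x        ≡⟨ cong (z ∙_) yx≡x ⟨
      z ∙ (y ∙ x)  ≡⟨ assoc z y x ⟨
      (z ∙ y) ∙ x  ≡⟨ cong (_∙ x) zy≡y ⟩
      y ∙ x        ≡⟨ yx≡x ⟩
      x            ∎)

    z≢y : z ≢ y
    z≢y z≡y = zy≢y (trans (cong (_∙ y) z≡y) (idempotent y))

  twin-upper : ∀ {x y} → (x ⊑ y × y ⊑ x) ⊎ (x ∙ y ≡ y × y ∙ x ≡ x) → ∀ {z} → x ⊏ z → y ⊏ z
  twin-upper (inj₁ (x⊑y , y⊑x)) (x⊑z , z⋢x) = ⊑-trans y⊑x x⊑z , λ z⊑y → z⋢x (⊑-trans z⊑y y⊑x)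
    where open IsPreorder ⊑-isPreorder using () renaming (trans to ⊑-trans)
  twin-upper {x} {y} (inj₂ (xy≡y , yx≡x)) {z} x⊏z = commuting⇒⊏ y≢z (xy≢y⇒xy≡x yz≢z) zy≡y
    where
    open ≡-Reasoning

    zy≡y : z ∙ y ≡ y
    zy≡y = begin
      z ∙ y        ≡⟨ cong (z ∙_) xy≡y ⟨
      z ∙ (x ∙ y)  ≡⟨ assoc z x y ⟨
      (z ∙ x) ∙ y  ≡⟨ cong (_∙ y) (⊏⇒yx≡x x⊏z) ⟩
      x ∙ y        ≡⟨ xy≡y ⟩
      y            ∎

    yz≢z : y ∙ z ≢ z
    yz≢z yz≡z = ⊏⇒≢ x⊏z (begin
      x            ≡⟨ proj₁ x⊏z ⟨
      x ∙ z        ≡⟨ cong (x ∙_) yz≡z ⟨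
      x ∙ (y ∙ z)  ≡⟨ assoc x y z ⟨
      (x ∙ y) ∙ z  ≡⟨ cong (_∙ z) xy≡y ⟩
      y ∙ z        ≡⟨ yz≡z ⟩
      z            ∎)

    y≢z : y ≢ z
    y≢z y≡z = yz≢z (trans (cong (_∙ z) y≡z) (idempotent z))

  ≤𝟏⇒comparable : ∀ {x y} → x ≤ 𝟏 → y ≤ 𝟏 → x ⊑ y ⊎ y ⊑ x
  ≤𝟏⇒comparable {x} {y} x≤𝟏 y≤𝟏 with total x y
  ... | inj₁ x≤y = inj₁ (from (⊑⇔≤ x≤𝟏 y≤𝟏) x≤y)
  ... | inj₂ y≤x = inj₂ (from (⊑⇔≤ y≤𝟏 x≤𝟏) y≤x)

  𝟏≤⇒comparable : ∀ {x y} → 𝟏 ≤ x → 𝟏 ≤ y → x ⊑ y ⊎ y ⊑ x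
  𝟏≤⇒comparable {x} {y} 𝟏≤x 𝟏≤y with total x y
  ... | inj₁ x≤y = inj₂ (from (⊑⇔≥ 𝟏≤y 𝟏≤x) x≤y)
  ... | inj₂ y≤x = inj₁ (from (⊑⇔≥ 𝟏≤x 𝟏≤y) y≤x)

  ≤𝟏⇒⊑-antisym : ∀ {x y} → x ≤ 𝟏 → y ≤ 𝟏 → x ⊑ y → y ⊑ x → x ≡ y
  ≤𝟏⇒⊑-antisym x≤𝟏 y≤𝟏 x⊑y y⊑x = antisym (to (⊑⇔≤ x≤𝟏 y≤𝟏) x⊑y) (to (⊑⇔≤ y≤𝟏 x≤𝟏) y⊑x)

  𝟏≤⇒⊑-antisym : ∀ {x y} → 𝟏 ≤ x → 𝟏 ≤ y → x ⊑ y → y ⊑ x → x ≡ y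
  𝟏≤⇒⊑-antisym 𝟏≤x 𝟏≤y x⊑y y⊑x = antisym (to (⊑⇔≥ 𝟏≤y 𝟏≤x) y⊑x) (to (⊑⇔≥ 𝟏≤x 𝟏≤y) x⊑y)

  comparable⇒¬twins : ∀ {x y} → (x ⊑ y → y ⊑ x → x ≡ y) → x ⊑ y ⊎ y ⊑ x →
                      x ≢ y → ¬ (x ⊏ y) → ¬ ¬ (y ⊏ x)
  comparable⇒¬twins ⊑-antisym (inj₁ x⊑y) x≢y ¬x⊏y _ =
    ¬x⊏y (x⊑y , x≢y ∘ ⊑-antisym x⊑y)
  comparable⇒¬twins ⊑-antisym (inj₂ y⊑x) x≢y _ ¬y⊏x =
    ¬y⊏x (y⊑x , λ x⊑y → x≢y (⊑-antisym x⊑y y⊑x))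

  twins-opposite : ∀ x y → x ≢ y → ¬ (x ⊏ y) → ¬ (y ⊏ x) →
                   (𝟏 ≤ x × y ≤ 𝟏) ⊎ (x ≤ 𝟏 × 𝟏 ≤ y)
  twins-opposite x y x≢y ¬x⊏y ¬y⊏x with total x 𝟏 | total y 𝟏
  ... | inj₁ x≤𝟏 | inj₂ 𝟏≤y = inj₂ (x≤𝟏 , 𝟏≤y)
  ... | inj₂ 𝟏≤x | inj₁ y≤𝟏 = inj₁ (𝟏≤x , y≤𝟏)
  ... | inj₁ x≤𝟏 | inj₁ y≤𝟏 = contradiction ¬y⊏x
    (comparable⇒¬twins (≤𝟏⇒⊑-antisym x≤𝟏 y≤𝟏) (≤𝟏⇒comparable x≤𝟏 y≤𝟏) x≢y ¬x⊏y)
  ... | inj₂ 𝟏≤x | inj₂ 𝟏≤y = contradiction ¬y⊏x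
    (comparable⇒¬twins (𝟏≤⇒⊑-antisym 𝟏≤x 𝟏≤y) (𝟏≤⇒comparable 𝟏≤x 𝟏≤y) x≢y ¬x⊏y)

  isEnhancedMonoidalPreorder : IsEnhancedMonoidalPreorder (toPreorder A)
  isEnhancedMonoidalPreorder = record
    { isPreorder      = ⊑-isPreorder
    ; ⊏-𝟏             = ⊏-𝟏
    ; P⁺-isTotalOrder = record
      { isPartialOrder = record
        { isPreorder = record
          { isEquivalence = On.isEquivalence proj₁ isEquivalence
          ; reflexive     = ⊑-reflexive
          ; trans         = ⊑-trans
          }
        ; antisym    = λ { {_ , 𝟏≤x} {_ , 𝟏≤y} → 𝟏≤⇒⊑-antisym 𝟏≤x 𝟏≤y }
        }
      ; total          = λ { (_ , 𝟏≤x) (_ , 𝟏≤y) → 𝟏≤⇒comparable 𝟏≤x 𝟏≤y }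
      }
    ; P⁻-isTotalOrder = record
      { isPartialOrder = record
        { isPreorder = record
          { isEquivalence = On.isEquivalence proj₁ isEquivalence
          ; reflexive     = ⊑-reflexive
          ; trans         = ⊑-trans
          }
        ; antisym    = λ { {_ , x≤𝟏} {_ , y≤𝟏} → ≤𝟏⇒⊑-antisym x≤𝟏 y≤𝟏 }
        }
      ; total          = λ { (_ , x≤𝟏) (_ , y≤𝟏) → ≤𝟏⇒comparable x≤𝟏 y≤𝟏 }
      }
    ; P⁺∪P⁻           = λ x → total 𝟏 x
    ; P⁺∩P⁻           = λ x → mk⇔ (λ (𝟏≤x , x≤𝟏) → antisym x≤𝟏 𝟏≤x)
                                  (λ { refl → ≤-refl , ≤-refl })
    ; 𝟏⋆              = antisym
        (≤-respˡ-≈ (identityˡ _) (proj₁ (to ⋆-adjoint ≤-refl)))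
        (from ⋆-adjoint (≤-reflexive (identityˡ 𝟏) , ≤-reflexive (identityˡ 𝟏)))
    ; ⋆-smallest      = ⋆-smallest
    ; ⋆-largest       = ⋆-largest
    ; twins           = λ x y x≢y ¬x⊏y ¬y⊏x →
        let xy-twins = equivalent-or-rightZero x≢y ¬x⊏y ¬y⊏x
            yx-twins = equivalent-or-rightZero (≢-sym x≢y) ¬y⊏x ¬x⊏y
        in twins-opposite x y x≢y ¬x⊏y ¬y⊏x
         , (twin-lower xy-twins , twin-lower yx-twins)
         , (twin-upper xy-twins , twin-upper yx-twins)
    }
    where
    open IsPreorder ⊑-isPreorder using ()
      renaming (reflexive to ⊑-reflexive; trans to ⊑-trans)

-- The idempotent residuated chain of an enhanced monoidal preorder.

module PreorderToChain {ℓ : Level} (em : ExcludedMiddle ℓ) {X : Set ℓ}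
                       (P : EnhancedMonoidalPreorder X) where
  open EnhancedMonoidalPreorder P
  open RawEnhancedMonoidalPreorder raw
  open IsEnhancedMonoidalPreorder isEnhancedMonoidalPreorder
  open IsPreorder isPreorder using () renaming (refl to ⊑-refl; trans to ⊑-trans)
  open RawResiduatedLattice (toChain em P) using (_≤_; _∙_; _\\_)

  infixl 8 _⊙_

  _⊙_ : Op₂ X
  x ⊙ y = when_then_else_ em (x ⊑ y) x y

  _ˡ _ʳ : Op₁ X
  x ˡ = proj₁ (inverses em P x)
  x ʳ = proj₁ (proj₂ (inverses em P x))

  ⊑-total⁺ : ∀ {x y} → x ∈ P⁺ → y ∈ P⁺ → x ⊑ y ⊎ y ⊑ x
  ⊑-total⁺ x⁺ y⁺ = IsTotalOrder.total P⁺-isTotalOrder (_ , x⁺) (_ , y⁺)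

  ⊑-total⁻ : ∀ {x y} → x ∈ P⁻ → y ∈ P⁻ → x ⊑ y ⊎ y ⊑ x
  ⊑-total⁻ x⁻ y⁻ = IsTotalOrder.total P⁻-isTotalOrder (_ , x⁻) (_ , y⁻)

  ⊑-antisym⁺ : ∀ {x y} → x ∈ P⁺ → y ∈ P⁺ → x ⊑ y → y ⊑ x → x ≡ y
  ⊑-antisym⁺ x⁺ y⁺ = IsTotalOrder.antisym P⁺-isTotalOrder {_ , x⁺} {_ , y⁺}

  ⊑-antisym⁻ : ∀ {x y} → x ∈ P⁻ → y ∈ P⁻ → x ⊑ y → y ⊑ x → x ≡ y
  ⊑-antisym⁻ x⁻ y⁻ = IsTotalOrder.antisym P⁻-isTotalOrder {_ , x⁻} {_ , y⁻}

  𝟏∈P⁺ : 𝟏 ∈ P⁺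
  𝟏∈P⁺ = proj₁ (from (P⁺∩P⁻ 𝟏) refl)

  𝟏∈P⁻ : 𝟏 ∈ P⁻
  𝟏∈P⁻ = proj₂ (from (P⁺∩P⁻ 𝟏) refl)

  P⁺∩P⁻⇒≡𝟏 : ∀ {x} → x ∈ P⁺ → x ∈ P⁻ → x ≡ 𝟏
  P⁺∩P⁻⇒≡𝟏 x⁺ x⁻ = to (P⁺∩P⁻ _) (x⁺ , x⁻)

  ∉P⁻⇒∈P⁺ : ∀ {x} → x ∉ P⁻ → x ∈ P⁺
  ∉P⁻⇒∈P⁺ {x} x∉P⁻ = [ id , (λ x⁻ → contradiction x⁻ x∉P⁻) ]′ (P⁺∪P⁻ x)

  x⊑𝟏 : ∀ {x} → x ⊑ 𝟏
  x⊑𝟏 {x} with em {x ≡ 𝟏}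
  ... | yes refl = ⊑-refl
  ... | no x≢𝟏   = proj₁ (⊏-𝟏 x x≢𝟏)

  𝟏⊑x⇒x≡𝟏 : ∀ {x} → 𝟏 ⊑ x → x ≡ 𝟏
  𝟏⊑x⇒x≡𝟏 {x} 𝟏⊑x with em {x ≡ 𝟏}
  ... | yes x≡𝟏 = x≡𝟏
  ... | no x≢𝟏  = contradiction 𝟏⊑x (proj₂ (⊏-𝟏 x x≢𝟏))

  ⊏-⊑-trans : ∀ {x y z} → x ⊏ y → y ⊑ z → x ⊏ z
  ⊏-⊑-trans (x⊑y , y⋢x) y⊑z = ⊑-trans x⊑y y⊑z , y⋢x ∘ ⊑-trans y⊑z

  ⊑-⊏-trans : ∀ {x y z} → x ⊑ y → y ⊏ z → x ⊏ z
  ⊑-⊏-trans x⊑y (y⊑z , z⋢y) = ⊑-trans x⊑y y⊑z , λ z⊑x → z⋢y (⊑-trans z⊑x x⊑y)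

  -- The mirror image of the transitivity of ⊑ under x ∙ y ↦ y ∙ x.
  ⋢-trans : ∀ {x y z} → x ≢ z → ¬ (x ⊑ y) → ¬ (y ⊑ z) → ¬ (x ⊑ z)
  ⋢-trans {x} {y} {z} x≢z x⋢y y⋢z x⊑z with em {y ⊑ x} | em {z ⊑ y}
  ... | yes y⊑x | _       = y⋢z (⊑-trans y⊑x x⊑z)
  ... | no _    | yes z⊑y = x⋢y (⊑-trans x⊑z z⊑y)
  -- Now `x` and `z` are both twins of `y`, hence both on the side opposite to `y`, where `⊑` is
  -- antisymmetric.
  ... | no y⋢x  | no z⋢y  = x≢z (≡-by-cases xy-opposite yz-opposite)
    where
    ⋢⇒≢ : ∀ {u v} → ¬ (u ⊑ v) → u ≢ v
    ⋢⇒≢ u⋢v refl = u⋢v ⊑-refl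

    xy-twins = twins x y (⋢⇒≢ x⋢y) (x⋢y ∘ proj₁) (y⋢x ∘ proj₁)
    yz-twins = twins y z (⋢⇒≢ y⋢z) (y⋢z ∘ proj₁) (z⋢y ∘ proj₁)

    xy-opposite = proj₁ xy-twins
    yz-opposite = proj₁ yz-twins

    z⊑x : z ⊑ x
    z⊑x with em {z ⊑ x}
    ... | yes z⊑x = z⊑x
    ... | no z⋢x  =
      -- Twins have the same strict upper bounds, so `x ⊏ z` would give `y ⊏ z`.
      contradiction (proj₁ (proj₁ (proj₂ (proj₂ xy-twins)) (x⊑z , z⋢x))) y⋢z

    ≡-by-cases : (x ∈ P⁺ × y ∈ P⁻) ⊎ (x ∈ P⁻ × y ∈ P⁺) →
                 (y ∈ P⁺ × z ∈ P⁻) ⊎ (y ∈ P⁻ × z ∈ P⁺) → x ≡ z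
    ≡-by-cases (inj₁ (x⁺ , _)) (inj₂ (_ , z⁺)) = ⊑-antisym⁺ x⁺ z⁺ x⊑z z⊑x
    ≡-by-cases (inj₂ (x⁻ , _)) (inj₁ (_ , z⁻)) = ⊑-antisym⁻ x⁻ z⁻ x⊑z z⊑x
    ≡-by-cases (inj₁ (_ , y⁻)) (inj₁ (y⁺ , _)) with refl ← P⁺∩P⁻⇒≡𝟏 y⁺ y⁻ = contradiction x⊑𝟏 x⋢y
    ≡-by-cases (inj₂ (_ , y⁺)) (inj₂ (y⁻ , _)) with refl ← P⁺∩P⁻⇒≡𝟏 y⁺ y⁻ = contradiction x⊑𝟏 x⋢y

  ⊙-⊑ : ∀ {x y} → x ⊑ y → x ⊙ y ≡ x
  ⊙-⊑ = when-true em

  ⊙-⋢ : ∀ {x y} → ¬ (x ⊑ y) → x ⊙ y ≡ y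
  ⊙-⋢ = when-false em

  ⊙-assoc : ∀ x y z → (x ⊙ y) ⊙ z ≡ x ⊙ (y ⊙ z)
  ⊙-assoc x y z with em {x ⊑ y} | em {y ⊑ z}
  ... | yes x⊑y | yes y⊑z = trans (⊙-⊑ (⊑-trans x⊑y y⊑z)) (sym (⊙-⊑ x⊑y))
  ... | yes _   | no _    = refl
  ... | no x⋢y  | yes y⊑z = trans (⊙-⊑ y⊑z) (sym (⊙-⋢ x⋢y))
  ... | no x⋢y  | no y⋢z  = trans (⊙-⋢ y⋢z) (sym x⊙z≡z)
    where
    x⊙z≡z : x ⊙ z ≡ z
    x⊙z≡z with em {x ≡ z}
    ... | yes refl = ⊙-⊑ ⊑-refl
    ... | no x≢z   = ⊙-⋢ (⋢-trans x≢z x⋢y y⋢z)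

  ⊙-identityˡ : ∀ x → 𝟏 ⊙ x ≡ x
  ⊙-identityˡ x with em {𝟏 ⊑ x}
  ... | yes 𝟏⊑x = sym (𝟏⊑x⇒x≡𝟏 𝟏⊑x)
  ... | no _    = refl

  -- The clauses of `≤` overlap because `𝟏` is in both `P⁺` and `P⁻`. A clause that makes `x`
  -- negative forces `x ≡ 𝟏`, and `𝟏` is the strict top of `⊑`.
  ≤-positive : ∀ {x y} → x ∈ P⁺ → x ≤ y → y ∈ P⁺ × y ⊑ x
  ≤-positive x⁺ (inj₁ (x⁻ , _ , x⊑y))
    with refl ← P⁺∩P⁻⇒≡𝟏 x⁺ x⁻
    with refl ← 𝟏⊑x⇒x≡𝟏 x⊑y = 𝟏∈P⁺ , ⊑-refl
  ≤-positive x⁺ (inj₂ (inj₁ (_ , y⁺ , y⊑x))) = y⁺ , y⊑x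
  ≤-positive x⁺ (inj₂ (inj₂ (x⁻ , y⁺)))
    with refl ← P⁺∩P⁻⇒≡𝟏 x⁺ x⁻ = y⁺ , x⊑𝟏

  ≤-negative : ∀ {x y} → y ∈ P⁻ → x ≤ y → x ∈ P⁻ × x ⊑ y
  ≤-negative y⁻ (inj₁ (x⁻ , _ , x⊑y)) = x⁻ , x⊑y
  ≤-negative y⁻ (inj₂ (inj₁ (_ , y⁺ , y⊑x)))
    with refl ← P⁺∩P⁻⇒≡𝟏 y⁺ y⁻
    with refl ← 𝟏⊑x⇒x≡𝟏 y⊑x = 𝟏∈P⁻ , ⊑-refl
  ≤-negative y⁻ (inj₂ (inj₂ (x⁻ , y⁺)))
    with refl ← P⁺∩P⁻⇒≡𝟏 y⁺ y⁻ = x⁻ , x⊑𝟏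

  ≤-refl : ∀ {x} → x ≤ x
  ≤-refl {x} with P⁺∪P⁻ x
  ... | inj₁ x⁺ = inj₂ (inj₁ (x⁺ , x⁺ , ⊑-refl))
  ... | inj₂ x⁻ = inj₁ (x⁻ , x⁻ , ⊑-refl)

  ≤-trans : ∀ {x y z} → x ≤ y → y ≤ z → x ≤ z
  ≤-trans {x} {y} {z} x≤y y≤z with P⁺∪P⁻ x | P⁺∪P⁻ z
  ... | inj₁ x⁺ | _ =
    let y⁺ , y⊑x = ≤-positive x⁺ x≤y
        z⁺ , z⊑y = ≤-positive y⁺ y≤z
    in inj₂ (inj₁ (x⁺ , z⁺ , ⊑-trans z⊑y y⊑x))
  ... | inj₂ x⁻ | inj₁ z⁺ = inj₂ (inj₂ (x⁻ , z⁺))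
  ... | inj₂ x⁻ | inj₂ z⁻ =
    let y⁻ , y⊑z = ≤-negative z⁻ y≤z
        _  , x⊑y = ≤-negative y⁻ x≤y
    in inj₁ (x⁻ , z⁻ , ⊑-trans x⊑y y⊑z)

  ≤-antisym : ∀ {x y} → x ≤ y → y ≤ x → x ≡ y
  ≤-antisym {x} x≤y y≤x with P⁺∪P⁻ x
  ... | inj₁ x⁺ =
    let y⁺ , y⊑x = ≤-positive x⁺ x≤y
    in ⊑-antisym⁺ x⁺ y⁺ (proj₂ (≤-positive y⁺ y≤x)) y⊑x
  ... | inj₂ x⁻ =
    let y⁻ , y⊑x = ≤-negative x⁻ y≤x
    in ⊑-antisym⁻ x⁻ y⁻ (proj₂ (≤-negative y⁻ x≤y)) y⊑x

  ≤-total : ∀ x y → x ≤ y ⊎ y ≤ x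
  ≤-total x y with P⁺∪P⁻ x | P⁺∪P⁻ y
  ... | inj₁ x⁺ | inj₂ y⁻ = inj₂ (inj₂ (inj₂ (y⁻ , x⁺)))
  ... | inj₂ x⁻ | inj₁ y⁺ = inj₁ (inj₂ (inj₂ (x⁻ , y⁺)))
  ... | inj₁ x⁺ | inj₁ y⁺ = [ (λ x⊑y → inj₂ (inj₂ (inj₁ (y⁺ , x⁺ , x⊑y))))
                            , (λ y⊑x → inj₁ (inj₂ (inj₁ (x⁺ , y⁺ , y⊑x)))) ]′ (⊑-total⁺ x⁺ y⁺)
  ... | inj₂ x⁻ | inj₂ y⁻ = [ (λ x⊑y → inj₁ (inj₁ (x⁻ , y⁻ , x⊑y)))
                            , (λ y⊑x → inj₂ (inj₁ (y⁻ , x⁻ , y⊑x))) ]′ (⊑-total⁻ x⁻ y⁻)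

  ≤-isTotalOrder : IsTotalOrder _≡_ _≤_
  ≤-isTotalOrder = record
    { isPartialOrder = record
      { isPreorder = record
        { isEquivalence = isEquivalence
        ; reflexive     = λ { refl → ≤-refl }
        ; trans         = ≤-trans
        }
      ; antisym    = ≤-antisym
      }
    ; total          = ≤-total
    }

  open MinMax em ≤-isTotalOrder

  ≤⇔⊒ : ∀ {x y} → x ∈ P⁺ → y ∈ P⁺ → (x ≤ y) ⇔ (y ⊑ x)
  ≤⇔⊒ x⁺ y⁺ = mk⇔ (proj₂ ∘ ≤-positive x⁺) (λ y⊑x → inj₂ (inj₁ (x⁺ , y⁺ , y⊑x)))

  ≤⇔⊑ : ∀ {x y} → x ∈ P⁻ → y ∈ P⁻ → (x ≤ y) ⇔ (x ⊑ y)
  ≤⇔⊑ x⁻ y⁻ = mk⇔ (proj₂ ∘ ≤-negative y⁻) (λ x⊑y → inj₁ (x⁻ , y⁻ , x⊑y))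

  -- The selected factor is negative, so it is `≤` any positive factor. Against a negative one, `≤`
  -- agrees with `⊑`, and the total order on `P⁻` makes the selected factor the `⊑`-lower one.
  ⊙-negative⇒∧ : ∀ {x y} → x ⊙ y ∈ P⁻ → x ∧ y ≡ x ⊙ y
  ⊙-negative⇒∧ {x} {y} xy⁻ with em {x ⊑ y}
  ... | yes x⊑y = x≤y⇒x∧y≡x
    ([ (λ y⁺ → inj₂ (inj₂ (xy⁻ , y⁺))) , (λ y⁻ → from (≤⇔⊑ xy⁻ y⁻) x⊑y) ]′ (P⁺∪P⁻ y))
  ... | no x⋢y with P⁺∪P⁻ x
  ...   | inj₁ x⁺ = y≤x⇒x∧y≡y (inj₂ (inj₂ (xy⁻ , x⁺)))
  ...   | inj₂ x⁻ = y≤x⇒x∧y≡y (from (≤⇔⊑ xy⁻ x⁻)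
    ([ (λ x⊑y → contradiction x⊑y x⋢y) , id ]′ (⊑-total⁻ x⁻ xy⁻)))

  ⊙-positive⇒∨ : ∀ {x y} → x ⊙ y ∈ P⁺ → x ∨ y ≡ x ⊙ y
  ⊙-positive⇒∨ {x} {y} xy⁺ with em {x ⊑ y}
  ... | yes x⊑y = y≤x⇒x∨y≡x
    ([ (λ y⁺ → from (≤⇔⊒ y⁺ xy⁺) x⊑y) , (λ y⁻ → inj₂ (inj₂ (y⁻ , xy⁺))) ]′ (P⁺∪P⁻ y))
  ... | no x⋢y with P⁺∪P⁻ x
  ...   | inj₂ x⁻ = x≤y⇒x∨y≡y (inj₂ (inj₂ (x⁻ , xy⁺)))
  ...   | inj₁ x⁺ = x≤y⇒x∨y≡y (from (≤⇔⊒ x⁺ xy⁺)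
    ([ (λ x⊑y → contradiction x⊑y x⋢y) , id ]′ (⊑-total⁺ x⁺ xy⁺)))

  -- One-sided inverses and the sign of the product.

  𝟏-inverses : ∀ {l r} → Inverses raw 𝟏 l r → l ≡ 𝟏 × r ≡ 𝟏
  𝟏-inverses (no-twin _)                    = 𝟏⋆ , 𝟏⋆
  𝟏-inverses (equivalent⁺ 𝟏≢b _ _ 𝟏⊑b _)    = contradiction (sym (𝟏⊑x⇒x≡𝟏 𝟏⊑b)) 𝟏≢b
  𝟏-inverses (equivalent⁻ a≢𝟏 _ _ _ 𝟏⊑a)    = contradiction (𝟏⊑x⇒x≡𝟏 𝟏⊑a) a≢𝟏
  𝟏-inverses (incomparable⁺ _ _ _ _ b⋢𝟏)    = contradiction x⊑𝟏 b⋢𝟏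
  𝟏-inverses (incomparable⁻ _ _ _ a⋢𝟏 _)    = contradiction x⊑𝟏 a⋢𝟏

  ⋆⊑⇔⊏ : ∀ {b x} → b ≢ 𝟏 → b ∈ P⁻ → x ∈ P⁺ → (b ⋆ ⊑ x) ⇔ (b ⊏ x)
  ⋆⊑⇔⊏ b≢𝟏 b⁻ x⁺ =
    let _ , b⊏b⋆ , least = ⋆-smallest _ b≢𝟏 b⁻
    in mk⇔ (⊏-⊑-trans b⊏b⋆) (least _ x⁺)

  ⊑⋆⇔⊏ : ∀ {a x} → a ≢ 𝟏 → a ∈ P⁺ → x ∈ P⁻ → (x ⊑ a ⋆) ⇔ (x ⊏ a)
  ⊑⋆⇔⊏ a≢𝟏 a⁺ x⁻ =
    let _ , a⋆⊏a , greatest = ⋆-largest _ a≢𝟏 a⁺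
    in mk⇔ (λ x⊑a⋆ → ⊑-⊏-trans x⊑a⋆ a⋆⊏a) (greatest _ x⁻)

  opposite⇒≢ : ∀ {a b} → b ≢ 𝟏 → a ∈ P⁺ → b ∈ P⁻ → a ≢ b
  opposite⇒≢ b≢𝟏 a⁺ b⁻ refl = b≢𝟏 (P⁺∩P⁻⇒≡𝟏 a⁺ b⁻)

  opposite⇒≢′ : ∀ {a b} → a ≢ 𝟏 → a ∈ P⁺ → b ∈ P⁻ → b ≢ a
  opposite⇒≢′ a≢𝟏 a⁺ b⁻ refl = a≢𝟏 (P⁺∩P⁻⇒≡𝟏 a⁺ b⁻)

  -- The inverse is the smallest positive `x` with `¬ (x ⊑ y)`. Without a twin, or with an
  -- equivalent one, which violates the condition, this means `y ⊏ x` and yields `y ⋆`. An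
  -- incomparable twin meets the condition without being strictly above `y`, and is itself the
  -- smallest.
  inverseˡ-negative : ∀ {y l r} → Inverses raw y l r → y ≢ 𝟏 → y ∈ P⁻ →
                      l ∈ P⁺ × (∀ {x} → x ∈ P⁺ → (l ⊑ x) ⇔ (¬ (x ⊑ y)))
  inverseˡ-negative {y} (no-twin compare) y≢𝟏 y⁻ =
    proj₁ (⋆-smallest y y≢𝟏 y⁻) , λ {x} x⁺ → ⇔.trans (⋆⊑⇔⊏ y≢𝟏 y⁻ x⁺) (mk⇔ proj₂ λ x⋢y →
      [ id , (λ x⊏y → contradiction (proj₁ x⊏y) x⋢y) ]′ (compare x (opposite⇒≢ y≢𝟏 x⁺ y⁻)))
  inverseˡ-negative {y} (equivalent⁻ _ a⁺ _ a⊑y y⊑a) y≢𝟏 y⁻ =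
    proj₁ (⋆-smallest y y≢𝟏 y⁻) , λ x⁺ → ⇔.trans (⋆⊑⇔⊏ y≢𝟏 y⁻ x⁺) (mk⇔ proj₂ λ x⋢y →
      [ (λ a⊑x → ⊑-trans y⊑a a⊑x)
      , (λ x⊑a → contradiction (⊑-trans x⊑a a⊑y) x⋢y) ]′ (⊑-total⁺ a⁺ x⁺) , x⋢y)
  inverseˡ-negative {y} (incomparable⁻ {a} _ a⁺ _ a⋢y y⋢a) _ _ =
    a⁺ , λ {x} x⁺ → mk⇔ (λ a⊑x x⊑y → a⋢y (⊑-trans a⊑x x⊑y)) (a⊑ x⁺)
    where
    a⊑ : ∀ {x} → x ∈ P⁺ → ¬ (x ⊑ y) → a ⊑ x
    a⊑ {x} x⁺ x⋢y with em {x ≡ a}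
    ... | yes refl = ⊑-refl
    ... | no x≢a   =
      -- Passing through `y`, `⋢-trans` excludes `x ⊑ a`, so totality of `P⁺` leaves `a ⊑ x`.
      [ id , (λ x⊑a → contradiction x⊑a (⋢-trans x≢a x⋢y y⋢a)) ]′ (⊑-total⁺ a⁺ x⁺)
  inverseˡ-negative (equivalent⁺ _ y⁺ _ _ _)   y≢𝟏 y⁻ = contradiction (P⁺∩P⁻⇒≡𝟏 y⁺ y⁻) y≢𝟏
  inverseˡ-negative (incomparable⁺ _ y⁺ _ _ _) y≢𝟏 y⁻ = contradiction (P⁺∩P⁻⇒≡𝟏 y⁺ y⁻) y≢𝟏

  -- Here the condition is `y ⊑ x`, which an equivalent twin meets and an incomparable one does not,
  -- so the roles of the two kinds are exchanged.
  inverseʳ-negative : ∀ {y l r} → Inverses raw y l r → y ≢ 𝟏 → y ∈ P⁻ →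
                      r ∈ P⁺ × (∀ {x} → x ∈ P⁺ → (r ⊑ x) ⇔ (y ⊑ x))
  inverseʳ-negative {y} (no-twin compare) y≢𝟏 y⁻ =
    proj₁ (⋆-smallest y y≢𝟏 y⁻) , λ {x} x⁺ → ⇔.trans (⋆⊑⇔⊏ y≢𝟏 y⁻ x⁺) (mk⇔ proj₁ λ y⊑x →
      [ id , (λ x⊏y → contradiction y⊑x (proj₂ x⊏y)) ]′ (compare x (opposite⇒≢ y≢𝟏 x⁺ y⁻)))
  inverseʳ-negative (equivalent⁻ _ a⁺ _ a⊑y y⊑a) _ _ =
    a⁺ , λ _ → mk⇔ (⊑-trans y⊑a) (⊑-trans a⊑y)
  inverseʳ-negative {y} (incomparable⁻ _ a⁺ _ a⋢y y⋢a) y≢𝟏 y⁻ =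
    proj₁ (⋆-smallest y y≢𝟏 y⁻) , λ x⁺ → ⇔.trans (⋆⊑⇔⊏ y≢𝟏 y⁻ x⁺) (mk⇔ proj₁ λ y⊑x → y⊑x , λ x⊑y →
      [ (λ a⊑x → a⋢y (⊑-trans a⊑x x⊑y)) , (λ x⊑a → y⋢a (⊑-trans y⊑x x⊑a)) ]′ (⊑-total⁺ a⁺ x⁺))
  inverseʳ-negative (equivalent⁺ _ y⁺ _ _ _)   y≢𝟏 y⁻ = contradiction (P⁺∩P⁻⇒≡𝟏 y⁺ y⁻) y≢𝟏
  inverseʳ-negative (incomparable⁺ _ y⁺ _ _ _) y≢𝟏 y⁻ = contradiction (P⁺∩P⁻⇒≡𝟏 y⁺ y⁻) y≢𝟏

  -- Dually, this is the largest negative `x` with `x ⊑ y`; an equivalent twin attains it, and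
  -- otherwise the condition is strict and yields `y ⋆`.
  inverseˡ-positive : ∀ {y l r} → Inverses raw y l r → y ≢ 𝟏 → y ∈ P⁺ →
                      l ∈ P⁻ × (∀ {x} → x ∈ P⁻ → (x ⊑ l) ⇔ (x ⊑ y))
  inverseˡ-positive {y} (no-twin compare) y≢𝟏 y⁺ =
    proj₁ (⋆-largest y y≢𝟏 y⁺) , λ {x} x⁻ → ⇔.trans (⊑⋆⇔⊏ y≢𝟏 y⁺ x⁻) (mk⇔ proj₁ λ x⊑y →
      [ (λ y⊏x → contradiction x⊑y (proj₂ y⊏x)) , id ]′ (compare x (opposite⇒≢′ y≢𝟏 y⁺ x⁻)))
  inverseˡ-positive (equivalent⁺ _ _ b⁻ y⊑b b⊑y) _ _ =
    b⁻ , λ _ → mk⇔ (λ x⊑b → ⊑-trans x⊑b b⊑y) (λ x⊑y → ⊑-trans x⊑y y⊑b)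
  inverseˡ-positive {y} (incomparable⁺ _ _ b⁻ y⋢b b⋢y) y≢𝟏 y⁺ =
    proj₁ (⋆-largest y y≢𝟏 y⁺) , λ x⁻ → ⇔.trans (⊑⋆⇔⊏ y≢𝟏 y⁺ x⁻) (mk⇔ proj₁ λ x⊑y → x⊑y , λ y⊑x →
      [ (λ b⊑x → b⋢y (⊑-trans b⊑x x⊑y)) , (λ x⊑b → y⋢b (⊑-trans y⊑x x⊑b)) ]′ (⊑-total⁻ b⁻ x⁻))
  inverseˡ-positive (equivalent⁻ _ _ y⁻ _ _)   y≢𝟏 y⁺ = contradiction (P⁺∩P⁻⇒≡𝟏 y⁺ y⁻) y≢𝟏
  inverseˡ-positive (incomparable⁻ _ _ y⁻ _ _) y≢𝟏 y⁺ = contradiction (P⁺∩P⁻⇒≡𝟏 y⁺ y⁻) y≢𝟏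

  inverseʳ-positive : ∀ {y l r} → Inverses raw y l r → y ≢ 𝟏 → y ∈ P⁺ →
                      r ∈ P⁻ × (∀ {x} → x ∈ P⁻ → (x ⊑ r) ⇔ (¬ (y ⊑ x)))
  inverseʳ-positive {y} (no-twin compare) y≢𝟏 y⁺ =
    proj₁ (⋆-largest y y≢𝟏 y⁺) , λ {x} x⁻ → ⇔.trans (⊑⋆⇔⊏ y≢𝟏 y⁺ x⁻) (mk⇔ proj₂ λ y⋢x →
      [ (λ y⊏x → contradiction (proj₁ y⊏x) y⋢x) , id ]′ (compare x (opposite⇒≢′ y≢𝟏 y⁺ x⁻)))
  inverseʳ-positive {y} (equivalent⁺ _ _ b⁻ y⊑b b⊑y) y≢𝟏 y⁺ =
    proj₁ (⋆-largest y y≢𝟏 y⁺) , λ x⁻ → ⇔.trans (⊑⋆⇔⊏ y≢𝟏 y⁺ x⁻) (mk⇔ proj₂ λ y⋢x →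
      [ (λ b⊑x → contradiction (⊑-trans y⊑b b⊑x) y⋢x)
      , (λ x⊑b → ⊑-trans x⊑b b⊑y) ]′ (⊑-total⁻ b⁻ x⁻) , y⋢x)
  inverseʳ-positive {y} (incomparable⁺ {b = b} _ _ b⁻ y⋢b b⋢y) _ _ =
    b⁻ , λ {x} x⁻ → mk⇔ (λ x⊑b y⊑x → y⋢b (⊑-trans y⊑x x⊑b)) (⊑b x⁻)
    where
    ⊑b : ∀ {x} → x ∈ P⁻ → ¬ (y ⊑ x) → x ⊑ b
    ⊑b {x} x⁻ y⋢x with em {b ≡ x}
    ... | yes refl = ⊑-refl
    ... | no b≢x   =
      [ (λ b⊑x → contradiction b⊑x (⋢-trans b≢x b⋢y y⋢x)) , id ]′ (⊑-total⁻ b⁻ x⁻)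
  inverseʳ-positive (equivalent⁻ _ _ y⁻ _ _)   y≢𝟏 y⁺ = contradiction (P⁺∩P⁻⇒≡𝟏 y⁺ y⁻) y≢𝟏
  inverseʳ-positive (incomparable⁻ _ _ y⁻ _ _) y≢𝟏 y⁺ = contradiction (P⁺∩P⁻⇒≡𝟏 y⁺ y⁻) y≢𝟏

  ≤𝟏⇔∈P⁻ : ∀ {x} → (x ≤ 𝟏) ⇔ (x ∈ P⁻)
  ≤𝟏⇔∈P⁻ = mk⇔ (proj₁ ∘ ≤-negative 𝟏∈P⁻) (λ x⁻ → inj₂ (inj₂ (x⁻ , 𝟏∈P⁺)))

  𝟏≤⇔∈P⁺ : ∀ {x} → (𝟏 ≤ x) ⇔ (x ∈ P⁺)
  𝟏≤⇔∈P⁺ = mk⇔ (proj₁ ∘ ≤-positive 𝟏∈P⁺) (λ x⁺ → inj₂ (inj₂ (𝟏∈P⁻ , x⁺)))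

  ⊙-negative : ∀ {x y} → x ∈ P⁻ → y ∈ P⁻ → x ⊙ y ∈ P⁻
  ⊙-negative {x} {y} x⁻ y⁻ with em {x ⊑ y}
  ... | yes _ = x⁻
  ... | no _  = y⁻

  ⊙-positive : ∀ {x y} → x ∈ P⁺ → y ∈ P⁺ → x ⊙ y ∈ P⁺
  ⊙-positive {x} {y} x⁺ y⁺ with em {x ⊑ y}
  ... | yes _ = x⁺
  ... | no _  = y⁺

  ⊙≡𝟏⇒≡𝟏 : ∀ {x y} → x ⊙ y ≡ 𝟏 → x ≡ 𝟏 × y ≡ 𝟏
  ⊙≡𝟏⇒≡𝟏 {x} {y} xy≡𝟏 with em {x ⊑ y}
  ⊙≡𝟏⇒≡𝟏 refl | yes 𝟏⊑y = refl , 𝟏⊑x⇒x≡𝟏 𝟏⊑y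
  ⊙≡𝟏⇒≡𝟏 refl | no x⋢𝟏  = contradiction x⊑𝟏 x⋢𝟏

  -- The disjunction excludes exactly `x ≡ y ≡ 𝟏`, where the product is negative although `x ⊑ y`.
  -- Either disjunct suffices, since the left inverse comes with `y ≢ 𝟏` and the right one with
  -- `x ≢ 𝟏`.
  ⊙-positive-negative : ∀ {x y} → y ≢ 𝟏 ⊎ x ≢ 𝟏 → x ∈ P⁺ → y ∈ P⁻ → (x ⊙ y ∈ P⁻) ⇔ (¬ (x ⊑ y))
  ⊙-positive-negative {x} {y} ≢𝟏 x⁺ y⁻ with em {x ⊑ y}
  ... | no x⋢y  = mk⇔ (λ _ → x⋢y) (λ _ → y⁻)
  ... | yes x⊑y = mk⇔ (λ x⁻ → [ (λ y≢𝟏 → contradiction (y≡𝟏 x⁻) y≢𝟏)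
                             , (λ x≢𝟏 → contradiction (P⁺∩P⁻⇒≡𝟏 x⁺ x⁻) x≢𝟏) ]′ ≢𝟏)
                      (contradiction x⊑y)
    where
    y≡𝟏 : x ∈ P⁻ → y ≡ 𝟏
    y≡𝟏 x⁻ = 𝟏⊑x⇒x≡𝟏 (subst (_⊑ y) (P⁺∩P⁻⇒≡𝟏 x⁺ x⁻) x⊑y)

  ⊙-negative-positive : ∀ {x y} → x ∈ P⁻ → y ∈ P⁺ → (x ⊙ y ∈ P⁻) ⇔ (x ⊑ y)
  ⊙-negative-positive {x} {y} x⁻ y⁺ with em {x ⊑ y}
  ... | yes x⊑y = mk⇔ (λ _ → x⊑y) (λ _ → x⁻)
  ... | no x⋢y  = mk⇔ (λ y⁻ → subst (x ⊑_) (sym (P⁺∩P⁻⇒≡𝟏 y⁺ y⁻)) x⊑𝟏)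
                      (λ x⊑y → contradiction x⊑y x⋢y)

  -- For opposite signs, the descriptions of the inverses reduce both sides to one comparison of `x`
  -- with `y`. Two negative factors make both sides true; two positive ones with `y ≢ 𝟏` make both
  -- false. Those descriptions exclude `y ≡ 𝟏`, which is treated directly.
  ≤ˡ⇔⊙∈P⁻ : ∀ {x y} → (x ≤ y ˡ) ⇔ (x ⊙ y ∈ P⁻)
  ≤ˡ⇔⊙∈P⁻ {x} {y} with em {y ≡ 𝟏}
  ... | yes refl rewrite proj₁ (𝟏-inverses (proj₂ (proj₂ (inverses em P 𝟏)))) | ⊙-⊑ (x⊑𝟏 {x}) = ≤𝟏⇔∈P⁻
  ... | no y≢𝟏 with P⁺∪P⁻ x | P⁺∪P⁻ y | proj₂ (proj₂ (inverses em P y))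
  ...   | inj₂ x⁻ | inj₂ y⁻ | y-inv =
    mk⇔ (λ _ → ⊙-negative x⁻ y⁻)
        (λ _ → inj₂ (inj₂ (x⁻ , proj₁ (inverseˡ-negative y-inv y≢𝟏 y⁻))))
  ...   | inj₁ x⁺ | inj₂ y⁻ | y-inv =
    let l⁺ , l⊑⇔ = inverseˡ-negative y-inv y≢𝟏 y⁻
    in ⇔.trans (≤⇔⊒ x⁺ l⁺) (⇔.trans (l⊑⇔ x⁺) (⇔.sym (⊙-positive-negative (inj₁ y≢𝟏) x⁺ y⁻)))
  ...   | inj₂ x⁻ | inj₁ y⁺ | y-inv =
    let l⁻ , ⊑l⇔ = inverseˡ-positive y-inv y≢𝟏 y⁺
    in ⇔.trans (≤⇔⊑ x⁻ l⁻) (⇔.trans (⊑l⇔ x⁻) (⇔.sym (⊙-negative-positive x⁻ y⁺)))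
  ...   | inj₁ x⁺ | inj₁ y⁺ | y-inv = mk⇔
    (λ x≤l → let l⁻ , ⊑l⇔ = inverseˡ-positive y-inv y≢𝟏 y⁺
                 x⁻ , x⊑l = ≤-negative l⁻ x≤l
                 x≡𝟏      = P⁺∩P⁻⇒≡𝟏 x⁺ x⁻
             in contradiction (𝟏⊑x⇒x≡𝟏 (subst (_⊑ y) x≡𝟏 (to (⊑l⇔ x⁻) x⊑l))) y≢𝟏)
    (λ xy⁻ → contradiction (proj₂ (⊙≡𝟏⇒≡𝟏 (P⁺∩P⁻⇒≡𝟏 (⊙-positive x⁺ y⁺) xy⁻))) y≢𝟏)

  ≤ʳ⇔⊙∈P⁻ : ∀ {x y} → (y ≤ x ʳ) ⇔ (x ⊙ y ∈ P⁻)
  ≤ʳ⇔⊙∈P⁻ {x} {y} with em {x ≡ 𝟏}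
  ... | yes refl rewrite proj₂ (𝟏-inverses (proj₂ (proj₂ (inverses em P 𝟏)))) | ⊙-identityˡ y = ≤𝟏⇔∈P⁻
  ... | no x≢𝟏 with P⁺∪P⁻ x | P⁺∪P⁻ y | proj₂ (proj₂ (inverses em P x))
  ...   | inj₂ x⁻ | inj₂ y⁻ | x-inv =
    mk⇔ (λ _ → ⊙-negative x⁻ y⁻)
        (λ _ → inj₂ (inj₂ (y⁻ , proj₁ (inverseʳ-negative x-inv x≢𝟏 x⁻))))
  ...   | inj₁ x⁺ | inj₂ y⁻ | x-inv =
    let r⁻ , ⊑r⇔ = inverseʳ-positive x-inv x≢𝟏 x⁺
    in ⇔.trans (≤⇔⊑ y⁻ r⁻) (⇔.trans (⊑r⇔ y⁻) (⇔.sym (⊙-positive-negative (inj₂ x≢𝟏) x⁺ y⁻)))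
  ...   | inj₂ x⁻ | inj₁ y⁺ | x-inv =
    let r⁺ , r⊑⇔ = inverseʳ-negative x-inv x≢𝟏 x⁻
    in ⇔.trans (≤⇔⊒ y⁺ r⁺) (⇔.trans (r⊑⇔ y⁺) (⇔.sym (⊙-negative-positive x⁻ y⁺)))
  ...   | inj₁ x⁺ | inj₁ y⁺ | x-inv = mk⇔
    (λ y≤r → let r⁻ , ⊑r⇔ = inverseʳ-positive x-inv x≢𝟏 x⁺
                 y⁻ , y⊑r = ≤-negative r⁻ y≤r
                 y≡𝟏      = P⁺∩P⁻⇒≡𝟏 y⁺ y⁻
             in contradiction (subst (x ⊑_) (sym y≡𝟏) x⊑𝟏) (to (⊑r⇔ y⁻) y⊑r))
    (λ xy⁻ → contradiction (proj₁ (⊙≡𝟏⇒≡𝟏 (P⁺∩P⁻⇒≡𝟏 (⊙-positive x⁺ y⁺) xy⁻))) x≢𝟏)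

  ∙≡⊙ : ∀ x y → x ∙ y ≡ x ⊙ y
  ∙≡⊙ x y with em {x ≤ y ˡ}
  ... | yes x≤yˡ = ⊙-negative⇒∧ (to ≤ˡ⇔⊙∈P⁻ x≤yˡ)
  ... | no x≰yˡ  = ⊙-positive⇒∨ (∉P⁻⇒∈P⁺ (x≰yˡ ∘ from ≤ˡ⇔⊙∈P⁻))

  ∙-isMonoid : IsMonoid _≡_ _∙_ 𝟏
  ∙-isMonoid = record
    { isSemigroup = record
      { isMagma = record { isEquivalence = isEquivalence ; ∙-cong = cong₂ _∙_ }
      ; assoc   = λ x y z → begin
          (x ∙ y) ∙ z  ≡⟨ ∙≡⊙ (x ∙ y) z ⟩
          (x ∙ y) ⊙ z  ≡⟨ cong (_⊙ z) (∙≡⊙ x y) ⟩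
          (x ⊙ y) ⊙ z  ≡⟨ ⊙-assoc x y z ⟩
          x ⊙ (y ⊙ z)  ≡⟨ cong (x ⊙_) (∙≡⊙ y z) ⟨
          x ⊙ (y ∙ z)  ≡⟨ ∙≡⊙ x (y ∙ z) ⟨
          x ∙ (y ∙ z)  ∎
      }
    ; identity    = (λ x → trans (∙≡⊙ 𝟏 x) (⊙-identityˡ x)) , (λ x → trans (∙≡⊙ x 𝟏) (⊙-⊑ x⊑𝟏))
    }
    where open ≡-Reasoning

  isIdempotentResiduatedChain : IsIdempotentResiduatedChain (toChain em P)
  isIdempotentResiduatedChain = record
    { isResiduatedLattice = record
      { isLattice = isLattice
      ; isMonoid  = ∙-isMonoid
      ; residual\ = λ x y z → ⇔.sym (subst (λ p → (p ≤ z) ⇔ (y ≤ x \\ z))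
          -- `residuation` is applied with the factors exchanged and the guard `x ≤ y ˡ` kept: that
          -- guard is equivalent to `y ≤ x ʳ`, both expressing a negative product, and commutativity
          -- of minimum and maximum restores the product.
          (cong₂ (when_then_else_ em (x ≤ y ˡ)) (∧-comm y x) (∨-comm y x))
          (residuation (⇔.trans ≤ˡ⇔⊙∈P⁻ (⇔.sym ≤ʳ⇔⊙∈P⁻))))
      ; residual/ = λ x y z → residuation ⇔.refl
      }
    ; total               = ≤-total
    ; idempotent          = λ x → trans (∙≡⊙ x x) (⊙-⊑ ⊑-refl)
    }

-- Uniqueness of the derived operations, and the two round trips.

module _ {ℓ : Level} {X : Set ℓ} {A B : RawResiduatedLattice X}
         (isA : IsResiduatedLattice A) (isB : IsResiduatedLattice B) where
  private
    module A where
      open RawResiduatedLattice A public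
      open IsResiduatedLattice isA public
      open IsLattice isLattice public using (∧-greatest; ∨-least; x∧y≤x; x∧y≤y; x≤x∨y; y≤x∨y)
        renaming (refl to ≤-refl)
    module B where
      open RawResiduatedLattice B public
      open IsResiduatedLattice isB public
      open IsLattice isLattice public using (antisym; ∧-greatest; ∨-least; x∧y≤x; x∧y≤y; x≤x∨y; y≤x∨y)
        renaming (refl to ≤-refl)

  -- Meets, joins and residuals are extremal for conditions stated with `≤` and `∙` alone. Each
  -- value computed in one algebra therefore satisfies the defining condition in the other, and
  -- antisymmetry identifies the two.
  residuatedLattice-≈ : (∀ x y → (x A.≤ y) ⇔ (x B.≤ y)) → (∀ x y → x A.∙ y ≡ x B.∙ y) →
                        A.𝟏 ≡ B.𝟏 → A ≈ᴬ B
  residuatedLattice-≈ ≤-≈ ∙-≈ 𝟏-≈ = record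
    { ≤-≈  = ≤-≈
    ; ∧-≈  = λ x y → B.antisym
        (B.∧-greatest (to (≤-≈ _ _) (A.x∧y≤x x y)) (to (≤-≈ _ _) (A.x∧y≤y x y)))
        (to (≤-≈ _ _) (A.∧-greatest (from (≤-≈ _ _) (B.x∧y≤x x y))
                                            (from (≤-≈ _ _) (B.x∧y≤y x y))))
    ; ∨-≈  = λ x y → B.antisym
        (to (≤-≈ _ _) (A.∨-least (from (≤-≈ _ _) (B.x≤x∨y x y))
                                         (from (≤-≈ _ _) (B.y≤x∨y x y))))
        (B.∨-least (to (≤-≈ _ _) (A.x≤x∨y x y)) (to (≤-≈ _ _) (A.y≤x∨y x y)))
    ; ∙-≈  = ∙-≈
    ; \\-≈ = λ x z → B.antisym
        (from (B.residual\ _ _ _) (to (∙-≤-≈ _ _ _) (to (A.residual\ _ _ _) A.≤-refl)))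
        (to (≤-≈ _ _) (from (A.residual\ _ _ _) (from (∙-≤-≈ _ _ _) (to (B.residual\ _ _ _) B.≤-refl))))
    ; //-≈ = λ z y → B.antisym
        (to (B.residual/ _ _ _) (to (∙-≤-≈ _ _ _) (from (A.residual/ _ _ _) A.≤-refl)))
        (to (≤-≈ _ _) (to (A.residual/ _ _ _) (from (∙-≤-≈ _ _ _) (from (B.residual/ _ _ _) B.≤-refl))))
    ; 𝟏-≈  = 𝟏-≈
    }
    where
    ∙-≤-≈ : ∀ x y z → (x A.∙ y A.≤ z) ⇔ (x B.∙ y B.≤ z)
    ∙-≤-≈ x y z = subst (λ p → (x A.∙ y A.≤ z) ⇔ (p B.≤ z)) (∙-≈ x y) (≤-≈ _ _)

module _ {ℓ : Level} (em : ExcludedMiddle ℓ) {X : Set ℓ} (A : IdempotentResiduatedChain X) where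
  open IdempotentResiduatedChain A
  open RawResiduatedLattice raw
  open IsIdempotentResiduatedChain isIdempotentResiduatedChain
  open IsResiduatedLattice isResiduatedLattice
  open IsLattice isLattice using () renaming (trans to ≤-trans)
  open ChainToPreorder A
  private
    P : EnhancedMonoidalPreorder X
    P = mkPreorder (toPreorder A) isEnhancedMonoidalPreorder

    module P = PreorderToChain em P
    module A′ = RawResiduatedLattice (toChain em P)

    ≤′⇔≤ : ∀ x y → (x A′.≤ y) ⇔ (x ≤ y)
    ≤′⇔≤ x y = mk⇔ ≤′⇒≤ ≤⇒≤′
      where
      ≤′⇒≤ : x A′.≤ y → x ≤ y
      ≤′⇒≤ (inj₁ (x≤𝟏 , y≤𝟏 , x⊑y))        = to (⊑⇔≤ x≤𝟏 y≤𝟏) x⊑y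
      ≤′⇒≤ (inj₂ (inj₁ (𝟏≤x , 𝟏≤y , y⊑x))) = to (⊑⇔≥ 𝟏≤y 𝟏≤x) y⊑x
      ≤′⇒≤ (inj₂ (inj₂ (x≤𝟏 , 𝟏≤y)))       = ≤-trans x≤𝟏 𝟏≤y

      ≤⇒≤′ : x ≤ y → x A′.≤ y
      ≤⇒≤′ x≤y with total x 𝟏 | total y 𝟏
      ... | inj₂ 𝟏≤x | _        =
        let 𝟏≤y = ≤-trans 𝟏≤x x≤y in inj₂ (inj₁ (𝟏≤x , 𝟏≤y , from (⊑⇔≥ 𝟏≤y 𝟏≤x) x≤y))
      ... | inj₁ x≤𝟏 | inj₁ y≤𝟏 = inj₁ (x≤𝟏 , y≤𝟏 , from (⊑⇔≤ x≤𝟏 y≤𝟏) x≤y)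
      ... | inj₁ x≤𝟏 | inj₂ 𝟏≤y = inj₂ (inj₂ (x≤𝟏 , 𝟏≤y))

    ⊙≡∙ : ∀ x y → x P.⊙ y ≡ x ∙ y
    -- The guard `x ⊑ y` of `⊙` unfolds to this equation.
    ⊙≡∙ x y with em {x ∙ y ≡ x}
    ... | yes xy≡x = sym xy≡x
    ... | no xy≢x  = sym (xy≢x⇒xy≡y xy≢x)

  chain-roundtrip : toChain em P ≈ᴬ raw
  chain-roundtrip = residuatedLattice-≈
    (IsIdempotentResiduatedChain.isResiduatedLattice P.isIdempotentResiduatedChain)
    isResiduatedLattice
    ≤′⇔≤ (λ x y → trans (P.∙≡⊙ x y) (⊙≡∙ x y)) refl

module _ {ℓ : Level} {X : Set ℓ} {P Q : RawEnhancedMonoidalPreorder X}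
         (isP : IsEnhancedMonoidalPreorder P) (isQ : IsEnhancedMonoidalPreorder Q) where
  private
    module P where
      open RawEnhancedMonoidalPreorder P public
      open IsEnhancedMonoidalPreorder isP public
    module Q where
      open RawEnhancedMonoidalPreorder Q public
      open IsEnhancedMonoidalPreorder isQ public

  ⊏-≈ : (∀ x y → (x P.⊑ y) ⇔ (x Q.⊑ y)) → ∀ {x y} → (x P.⊏ y) ⇔ (x Q.⊏ y)
  ⊏-≈ ⊑-≈ = mk⇔ (λ (x⊑y , y⋢x) → to (⊑-≈ _ _) x⊑y , y⋢x ∘ from (⊑-≈ _ _))
                (λ (x⊑y , y⋢x) → from (⊑-≈ _ _) x⊑y , y⋢x ∘ to (⊑-≈ _ _))

  -- Away from `𝟏`, axioms (1) and (2) make `x ⋆` extremal in a subset on which `⊑` is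
  -- antisymmetric. Hence the `⋆` computed from the residuals of `A` need not be evaluated to be
  -- recognised as the original one.
  ⋆-unique : ExcludedMiddle ℓ →
             (∀ x y → (x P.⊑ y) ⇔ (x Q.⊑ y)) →
             (∀ x → (x ∈ P.P⁺) ⇔ (x ∈ Q.P⁺)) → (∀ x → (x ∈ P.P⁻) ⇔ (x ∈ Q.P⁻)) →
             P.𝟏 ≡ Q.𝟏 → ∀ x → x P.⋆ ≡ x Q.⋆
  ⋆-unique em ⊑-≈ P⁺-≈ P⁻-≈ refl x with em {x ≡ P.𝟏}
  ... | yes refl = trans P.𝟏⋆ (sym Q.𝟏⋆)
  ... | no x≢𝟏 with P.P⁺∪P⁻ x
  ...   | inj₁ x⁺ =
    let p⁻ , p⊏x , p-largest = P.⋆-largest x x≢𝟏 x⁺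
        q⁻ , q⊏x , q-largest = Q.⋆-largest x x≢𝟏 (to (P⁺-≈ x) x⁺)
    in IsTotalOrder.antisym Q.P⁻-isTotalOrder {_ , to (P⁻-≈ _) p⁻} {_ , q⁻}
         (q-largest _ (to (P⁻-≈ _) p⁻) (to (⊏-≈ ⊑-≈) p⊏x))
         (to (⊑-≈ _ _) (p-largest _ (from (P⁻-≈ _) q⁻) (from (⊏-≈ ⊑-≈) q⊏x)))
  ...   | inj₂ x⁻ =
    let p⁺ , x⊏p , p-smallest = P.⋆-smallest x x≢𝟏 x⁻
        q⁺ , x⊏q , q-smallest = Q.⋆-smallest x x≢𝟏 (to (P⁻-≈ x) x⁻)
    in IsTotalOrder.antisym Q.P⁺-isTotalOrder {_ , to (P⁺-≈ _) p⁺} {_ , q⁺}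
         (to (⊑-≈ _ _) (p-smallest _ (from (P⁺-≈ _) q⁺) (from (⊏-≈ ⊑-≈) x⊏q)))
         (q-smallest _ (to (P⁺-≈ _) p⁺) (to (⊏-≈ ⊑-≈) x⊏p))

module _ {ℓ : Level} (em : ExcludedMiddle ℓ) {X : Set ℓ} (P : EnhancedMonoidalPreorder X) where
  open EnhancedMonoidalPreorder P
  open RawEnhancedMonoidalPreorder raw
  open IsEnhancedMonoidalPreorder isEnhancedMonoidalPreorder
  open IsPreorder isPreorder using () renaming (refl to ⊑-refl)
  open PreorderToChain em P
  open RawResiduatedLattice (toChain em P) using (_∙_)
  private
    A : IdempotentResiduatedChain X
    A = mkChain (toChain em P) isIdempotentResiduatedChain

    ∙≡x⇔⊑ : ∀ x y → (x ∙ y ≡ x) ⇔ (x ⊑ y)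
    ∙≡x⇔⊑ x y = mk⇔ ∙≡x⇒⊑ (λ x⊑y → trans (∙≡⊙ x y) (⊙-⊑ x⊑y))
      where
      ∙≡x⇒⊑ : x ∙ y ≡ x → x ⊑ y
      ∙≡x⇒⊑ xy≡x with em {x ⊑ y}
      ... | yes x⊑y = x⊑y
      ... | no x⋢y  =
        subst (x ⊑_) (trans (sym xy≡x) (trans (∙≡⊙ x y) (⊙-⋢ x⋢y))) ⊑-refl

  preorder-roundtrip : toPreorder A ≈ᴾ raw
  preorder-roundtrip = record
    { ⊑-≈  = ∙≡x⇔⊑
    ; P⁺-≈ = to 𝟏≤⇔∈P⁺ , from 𝟏≤⇔∈P⁺
    ; P⁻-≈ = to ≤𝟏⇔∈P⁻ , from ≤𝟏⇔∈P⁻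
    ; 𝟏-≈  = refl
    ; ⋆-≈  = ⋆-unique (ChainToPreorder.isEnhancedMonoidalPreorder A) isEnhancedMonoidalPreorder em
               ∙≡x⇔⊑ (λ _ → 𝟏≤⇔∈P⁺) (λ _ → ≤𝟏⇔∈P⁻) refl
    }

corollary4p13 : ∀ {ℓ : Level} (em : ExcludedMiddle ℓ) {X : Set ℓ} →
    Σ ((A : IdempotentResiduatedChain X) → IsEnhancedMonoidalPreorder (toPreorder A)) λ isEMP →
    Σ ((P : EnhancedMonoidalPreorder X) → IsIdempotentResiduatedChain (toChain em P)) λ isIRC →
      ((A : IdempotentResiduatedChain X) →
        toChain em (mkPreorder (toPreorder A) (isEMP A))
          ≈ᴬ IdempotentResiduatedChain.raw A)
      ×
      ((P : EnhancedMonoidalPreorder X) →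
        toPreorder (mkChain (toChain em P) (isIRC P))
          ≈ᴾ EnhancedMonoidalPreorder.raw P)
corollary4p13 em =
    ChainToPreorder.isEnhancedMonoidalPreorder
  , PreorderToChain.isIdempotentResiduatedChain em
  , chain-roundtrip em
  , preorder-roundtrip em
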